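{- Let $\Gamma=(V\uplus A,E,\alpha,c,\lambda)$ be a gainy marked network with at least all sinks marked. Then the transfer map $\phi_\Gamma\colon\mathbb{R}^V\to\mathbb{R}^V$, $$\phi_\Gamma(x)_v = x_v-\max_{v\xrightarrow{e}w}(\alpha_e x_w+c_e)\quad (v\in V),$$ restricts to a piecewise-linear homeomorphism $\mathcal{O}(\Gamma)\to\mathcal{C}(\Gamma)$.
   Context: A marked network $\Gamma=(V\uplus A,E,\alpha,c,\lambda)$ consists of a finite loop-free directed multigraph on the node set $V\uplus A$ with edge set $E$ (nodes in $A$ are called marked, nodes in $V$ unmarked), weights $\alpha_e,c_e\in\mathbb{R}$ with $\alpha_e>0$ for each edge $e\in E$, and a marking $\lambda\in\mathbb{R}^A$. For $x\in\mathbb{R}^V$ one sets $x_a:=\lambda_a$ for $a\in A$. A sink is a node without outgoing edges; "all sinks marked" means every sink lies in $A$. In the definition of $\phi_\Gamma$ the maximum is over all edges $e$ starting in $v$ (with $w$ the end node of $e$). The polyhedron $\mathcal{O}(\Gamma)\subseteq\mathbb{R}^V$ is the set of all $x\in\mathbb{R}^V$ with $\alpha_e x_w+c_e\le x_v$ for all edges $v\xrightarrow{e}w$ in $E$. A path is a finite walk with pairwise distinct nodes (length $0$ allowed). A cycle is a finite walk $v_1\xrightarrow{e_1}v_2\to\cdots\xrightarrow{e_r}v_{r+1}=v_1$ ($r\ge 1$) with $v_1,\dots,v_r$ pairwise distinct. The weight of a finite walk with edges $e_1,\dots,e_r$ is $\prod_{i=1}^r\alpha_{e_i}$. The network is gainy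 if every cycle $C$ has weight $\alpha(C)<1$. $\mathcal{W}$ is the set consisting of all finite walks $v_1\xrightarrow{e_1}\cdots\xrightarrow{e_r}v_{r+1}$ ($r\ge0$) with $v_i\in V$ for $i\le r$ and $v_{r+1}\in A$, and all infinite walks $v_1\xrightarrow{e_1}v_2\xrightarrow{e_2}\cdots$ with all $v_i\in V$. For $W\in\mathcal{W}$ and $x\in\mathbb{R}^V$: if $W$ is finite, $$\Sigma(W)(x)=\sum_{k=1}^r\Big(\prod_{j=1}^{k-1}\alpha_{e_j}\Big)(x_{v_k}+c_{e_k})+\Big(\prod_{j=1}^r\alpha_{e_j}\Big)x_{v_{r+1}};$$ if $W$ is infinite, $\Sigma(W)(x)=\sum_{k=1}^\infty\big(\prod_{j=1}^{k-1}\alpha_{e_j}\big)(x_{v_k}+c_{e_k})$ (for gainy networks this series converges absolutely). $\widehat{\mathcal{W}}\subseteq\mathcal{W}$ is the subset of walks that are either a path (necessarily ending in a marked node) or a monocycle, i.e. an infinite walk of the form $v_1\xrightarrow{e_1}\cdots\xrightarrow{e_{s-1}}v_s\xrightarrow{e_s}\cdots\xrightarrow{e_{r-1}}v_r\xrightarrow{e_r}v_s\xrightarrow{e_s}\cdots$ which after reaching $v_s$ repeats the cycle $v_s\xrightarrow{e_s}\cdots\xrightarrow{e_{r-1}}v_r\xrightarrow{e_r}v_s$ forever, with $v_1,\dots,v_r\in V$ pairwise distinct and $1\le s\le r$. The polyhedron $\mathcal{C}(\Gamma)\subseteq\mathbb{R}^V$ is the set of all $y\in\mathbb{R}^V$ with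 $y\ge 0$ (componentwise) and $\alpha_e\Sigma(W)(y)+c_e\le\lambda_a$ for each $a\in A$, each edge $e$ starting in $a$, and each $W\in\widehat{\mathcal{W}}$ starting in the end node of $e$. "Piecewise-linear" means piecewise affine-linear. -}

module Defs where

open import Algebra.Bundles using (CommutativeRing)
import Algebra.Construct.NaturalChoice.Max as NaturalMax
import Algebra.Definitions.RawMonoid as RawMonoidDefs
open import Data.Empty using (⊥; ⊥-elim)
open import Data.Fin.Base using (Fin)
import Data.Fin.Properties as Fin
open import Data.List.Base using (List; []; _∷_; map; filter; allFin)
import Data.List.Extrema as Extrema
open import Data.List.Membership.Propositional using (_∈_)
open import Data.List.Membership.Propositional.Properties using (∈-filter⁺; ∈-allFin)
open import Data.List.NonEmpty.Base using (List⁺; _∷_)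
open import Data.List.Relation.Unary.All using (All)
open import Data.List.Relation.Unary.Any using (Any)
open import Data.List.Relation.Unary.Unique.Propositional using (Unique)
open import Data.Nat.Base as ℕ using (ℕ; zero; suc)
open import Data.Product.Base using (Σ-syntax; ∃-syntax; _×_; _,_; proj₁; proj₂)
open import Data.Sum.Base using (_⊎_; inj₁; inj₂)
open import Data.Sum.Properties using (≡-dec)
open import Level using (0ℓ)
open import Relation.Binary.Bundles using (TotalOrder)
open import Relation.Binary.Construct.Closure.ReflexiveTransitive using (Star; ε; _◅_)
import Relation.Binary.Construct.NonStrictToStrict as NonStrictToStrict
open import Relation.Binary.Core using (Rel)
open import Relation.Binary.Definitions using (DecidableEquality)
open import Relation.Binary.PropositionalEquality.Core using (_≡_; _≢_; refl; subst)
open import Relation.Binary.Structures using (IsDecTotalOrder)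
open import Relation.Nullary using (¬_)
open import Relation.Unary using (Pred)

toNonEmpty : ∀ {B : Set} (bs : List B) → bs ≢ [] → List⁺ B
toNonEmpty []       []≢[] = ⊥-elim ([]≢[] refl)
toNonEmpty (b ∷ bs) _     = b ∷ bs

-- The real numbers are given axiomatically, as a Cauchy complete Archimedean
-- ordered field; classically these axioms determine ℝ up to unique isomorphism.
-- The order is decidable, since the mathematics formalised here is classical.
record RealNumbers : Set₁ where
  infix 4 _≤_
  field
    commutativeRing : CommutativeRing 0ℓ 0ℓ

  open CommutativeRing commutativeRing public

  field
    _≤_             : Rel Carrier 0ℓ
    isDecTotalOrder : IsDecTotalOrder _≈_ _≤_

  totalOrder : TotalOrder 0ℓ 0ℓ 0ℓ
  totalOrder = record { isTotalOrder = IsDecTotalOrder.isTotalOrder isDecTotalOrder }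

  open NonStrictToStrict _≈_ _≤_ public using (_<_)
  open NaturalMax totalOrder public using (_⊔_)
  open RawMonoidDefs +-rawMonoid public using (sum) renaming (_×_ to _·_)

  ∣_∣ : Carrier → Carrier
  ∣ x ∣ = x ⊔ - x

  IsCauchy : (ℕ → Carrier) → Set
  IsCauchy s = ∀ δ → 0# < δ →
    ∃[ N ] (∀ m n → N ℕ.≤ m → N ℕ.≤ n → ∣ s m - s n ∣ < δ)

  ConvergesTo : (ℕ → Carrier) → Carrier → Set
  ConvergesTo s l = ∀ δ → 0# < δ →
    ∃[ N ] (∀ n → N ℕ.≤ n → ∣ s n - l ∣ < δ)

  field
    0≉1         : ¬ (0# ≈ 1#)
    inverse     : ∀ x → ¬ (x ≈ 0#) → ∃[ y ] (x * y ≈ 1#)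
    +-monoˡ-≤   : ∀ z {x y} → x ≤ y → x + z ≤ y + z
    *-nonNeg    : ∀ {x y} → 0# ≤ x → 0# ≤ y → 0# ≤ x * y
    archimedean : ∀ x → ∃[ n ] (x ≤ n · 1#)
    complete    : ∀ s → IsCauchy s → ∃[ l ] ConvergesTo s l

module _ (ℝ : RealNumbers) where
  open RealNumbers ℝ hiding (refl)

  Point : ℕ → Set
  Point n = Fin n → Carrier

  maximumOf : ∀ {B : Set} → (B → Carrier) → List⁺ B → Carrier
  maximumOf f (b ∷ bs) = Extrema.max totalOrder (f b) (map f bs)

  record AffineForm (n : ℕ) : Set where
    field
      coefficient : Fin n → Carrier
      constant    : Carrier

    eval : Point n → Carrier
    eval x = sum (λ i → coefficient i * x i) + constant

  open AffineForm

  -- A list of forms stands for the polyhedron on which all of them are nonnegative.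
  Polyhedron : ℕ → Set
  Polyhedron n = List (AffineForm n)

  InPolyhedron : ∀ {n} → Polyhedron n → Pred (Point n) 0ℓ
  InPolyhedron H x = All (λ h → 0# ≤ eval h x) H

  MapsTo : ∀ {n m} → Pred (Point n) 0ℓ → Pred (Point m) 0ℓ → (Point n → Point m) → Set
  MapsTo P Q f = ∀ x → P x → Q (f x)

  -- Continuity for the subspace topology on P; the topology of ℝⁿ is that of
  -- the maximum norm.
  ContinuousOn : ∀ {n m} → Pred (Point n) 0ℓ → (Point n → Point m) → Set
  ContinuousOn P f = ∀ x → P x → ∀ η → 0# < η →
    ∃[ δ ] (0# < δ ×
      (∀ x′ → P x′ → (∀ i → ∣ x′ i - x i ∣ < δ) → ∀ j → ∣ f x′ j - f x j ∣ < η))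

  -- P is covered by finitely many polyhedra, and f agrees with an affine map
  -- on the part of P in each of them.
  PiecewiseLinearOn : ∀ {n m} → Pred (Point n) 0ℓ → (Point n → Point m) → Set
  PiecewiseLinearOn {n} {m} P f =
    Σ[ pieces ∈ List (Polyhedron n × (Fin m → AffineForm n)) ]
      (∀ x → P x → Any (λ piece → InPolyhedron (proj₁ piece) x) pieces) ×
      All (λ piece → ∀ x → P x → InPolyhedron (proj₁ piece) x →
                     ∀ j → f x j ≈ eval (proj₂ piece j) x) pieces

  -- Only the values of the inverse on Q matter; it is a function on the ambient
  -- space merely to avoid maps defined on subsets.
  record RestrictsToPLHomeomorphism {n m : ℕ} (P : Pred (Point n) 0ℓ) (Q : Pred (Point m) 0ℓ)
                                    (f : Point n → Point m) : Set where
    field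
      inverseMap              : Point m → Point n
      mapsTo                  : MapsTo P Q f
      inverse-mapsTo          : MapsTo Q P inverseMap
      inverseˡ                : ∀ x → P x → ∀ i → inverseMap (f x) i ≈ x i
      inverseʳ                : ∀ y → Q y → ∀ j → f (inverseMap y) j ≈ y j
      continuous              : ContinuousOn P f
      inverse-continuous      : ContinuousOn Q inverseMap
      piecewiseLinear         : PiecewiseLinearOn P f
      inverse-piecewiseLinear : PiecewiseLinearOn Q inverseMap

  -- V = Fin #V, A = Fin #A, E = Fin #E; in the node set V ⊎ A the unmarked
  -- nodes are those of the form inj₁ v.
  record MarkedNetwork : Set where
    field
      #V #A #E      : ℕ
      source target : Fin #E → Fin #V ⊎ Fin #A
      loopFree      : ∀ e → source e ≢ target e
      α c           : Fin #E → Carrier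
      α-positive    : ∀ e → 0# < α e
      marking       : Fin #A → Carrier

module _ {ℝ : RealNumbers} (Γ : MarkedNetwork ℝ) where
  open RealNumbers ℝ hiding (refl)
  open MarkedNetwork Γ

  Edge Node : Set
  Edge = Fin #E
  Node = Fin #V ⊎ Fin #A

  IsMarked IsUnmarked IsSink : Node → Set
  IsMarked u   = ∃[ a ] (u ≡ inj₂ a)
  IsUnmarked u = ∃[ v ] (u ≡ inj₁ v)
  IsSink u     = ∀ e → source e ≢ u

  AllSinksMarked : Set
  AllSinksMarked = ∀ u → IsSink u → IsMarked u

  extend : Point ℝ #V → Node → Carrier
  extend x (inj₁ v) = x v
  extend x (inj₂ a) = marking a

  record Step (u w : Node) : Set where
    constructor step
    field
      edge     : Edge
      source-≡ : source edge ≡ u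
      target-≡ : target edge ≡ w

  open Step

  FiniteWalk : Node → Node → Set
  FiniteWalk = Star Step

  nodes : ∀ {u w} → FiniteWalk u w → List Node
  nodes {u} ε       = u ∷ []
  nodes {u} (_ ◅ W) = u ∷ nodes W

  -- All nodes v₁, …, v_r of a walk except its end node v_{r+1}.
  departures : ∀ {u w} → FiniteWalk u w → List Node
  departures     ε       = []
  departures {u} (_ ◅ W) = u ∷ departures W

  weight : ∀ {u w} → FiniteWalk u w → Carrier
  weight ε       = 1#
  weight (s ◅ W) = α (edge s) * weight W

  IsPath : ∀ {u w} → FiniteWalk u w → Set
  IsPath W = Unique (nodes W)

  IsCycle : ∀ {u} → FiniteWalk u u → Set
  IsCycle C = departures C ≢ [] × Unique (departures C)

  Gainy : Set
  Gainy = ∀ {u} (C : FiniteWalk u u) → IsCycle C → weight C < 1#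

  -- Infinite walks are indexed from 0: the edge es k leads from vs k to vs (suc k).
  data 𝒲 (u : Node) : Set where
    finite   : ∀ {a} (W : FiniteWalk u (inj₂ a)) → All IsUnmarked (departures W) → 𝒲 u
    infinite : (vs : ℕ → Fin #V) (es : ℕ → Edge) →
               u ≡ inj₁ (vs 0) →
               (∀ k → source (es k) ≡ inj₁ (vs k)) →
               (∀ k → target (es k) ≡ inj₁ (vs (suc k))) →
               𝒲 u

  -- An infinite walk is a monocycle if, for some stem length s and period p > 0,
  -- its first s + p nodes are distinct and its edges repeat with period p from
  -- index s on.
  IsMonocycle : (ℕ → Fin #V) → (ℕ → Edge) → Set
  IsMonocycle vs es = ∃[ s ] ∃[ p ] (0 ℕ.< p ×
    (∀ i j → i ℕ.< s ℕ.+ p → j ℕ.< s ℕ.+ p → vs i ≡ vs j → i ≡ j) ×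
    (∀ k → s ℕ.≤ k → es (k ℕ.+ p) ≡ es k))

  In𝒲̂ : ∀ {u} → 𝒲 u → Set
  In𝒲̂ (finite W _)             = IsPath W
  In𝒲̂ (infinite vs es _ _ _) = IsMonocycle vs es

  -- The first argument is the product of the weights of the edges already traversed.
  finiteSumFrom : ∀ {u w} → Carrier → FiniteWalk u w → Point ℝ #V → Carrier
  finiteSumFrom {u} p ε       x = p * extend x u
  finiteSumFrom {u} p (s ◅ W) x =
    p * (extend x u + c (edge s)) + finiteSumFrom (p * α (edge s)) W x

  prefixWeight : (ℕ → Edge) → ℕ → Carrier
  prefixWeight es zero      = 1#
  prefixWeight es (suc k) = prefixWeight es k * α (es k)

  partialSum : (ℕ → Fin #V) → (ℕ → Edge) → Point ℝ #V → ℕ → Carrier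
  partialSum vs es x zero      = 0#
  partialSum vs es x (suc k) =
    partialSum vs es x k + prefixWeight es k * (x (vs k) + c (es k))

  -- HasSum W x s says that Σ(W)(x) is defined and equal to s; it is a relation
  -- because for an infinite walk Σ(W)(x) is a limit.
  HasSum : ∀ {u} → 𝒲 u → Point ℝ #V → Carrier → Set
  HasSum (finite W _)           x s = finiteSumFrom 1# W x ≈ s
  HasSum (infinite vs es _ _ _) x s = ConvergesTo (partialSum vs es x) s

  𝒪 : Pred (Point ℝ #V) 0ℓ
  𝒪 x = ∀ e → α e * extend x (target e) + c e ≤ extend x (source e)

  𝒞 : Pred (Point ℝ #V) 0ℓ
  𝒞 y = (∀ v → 0# ≤ y v) ×
        (∀ a e → source e ≡ inj₂ a → (W : 𝒲 (target e)) → In𝒲̂ W →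
           ∃[ s ] (HasSum W y s × α e * s + c e ≤ marking a))

  _≟ᴺ_ : DecidableEquality Node
  _≟ᴺ_ = ≡-dec Fin._≟_ Fin._≟_

  outgoing : Fin #V → List Edge
  outgoing v = filter (λ e → source e ≟ᴺ inj₁ v) (allFin #E)

  outgoing≢[] : AllSinksMarked → ∀ v → outgoing v ≢ []
  outgoing≢[] sinksMarked v none = unmarked (sinksMarked (inj₁ v) isSink)
    where
    unmarked : IsMarked (inj₁ v) → ⊥
    unmarked (_ , ())

    isSink : IsSink (inj₁ v)
    isSink e e-from-v
      with subst (e ∈_) none (∈-filter⁺ (λ e′ → source e′ ≟ᴺ inj₁ v) (∈-allFin e) e-from-v)
    ... | ()

  -- The hypothesis on sinks guarantees that the maximum is over a nonempty set.
  φ : AllSinksMarked → Point ℝ #V → Point ℝ #V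
  φ sinksMarked x v =
    x v - maximumOf ℝ (λ e → α e * extend x (target e) + c e)
                      (toNonEmpty (outgoing v) (outgoing≢[] sinksMarked v))

{-# OPTIONS --safe #-}

-- Writing y = φ(x), a point x satisfies x_v = y_v + max_e (α_e x_w + c_e) for all
-- v; the inverse of φ solves this Bellman equation for x. A policy chooses an edge
-- π(v) at every unmarked node v. Following π from any node leads to a marked node
-- or into a cycle, whose weight is less than 1. Hence the linear system
-- x_v = y_v + α_{π(v)} x_w + c_{π(v)} has a solution, affine in y, and a function
-- that is a subsolution for π lies below it. A policy maximising the sum of the
-- values solves the Bellman equation, since switching to a better edge would
-- increase that sum; the solution is unique by comparison along a greedy policy.
-- The finitely many policies give the linear pieces of φ and of its inverse, and
-- a piecewise-linear map is continuous. The inequalities of 𝒞 hold for φ(x) since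
-- Σ(W)(y) ≤ x_w for all walks W from w; conversely x_w = Σ(W)(y) for the walk from
-- w that follows an optimal policy, and this walk is in 𝒲̂.

module Submission where

open import Algebra.Bundles using (CommutativeRing)
import Algebra.Construct.NaturalChoice.Max as NaturalMax
import Algebra.Properties.Ring as RingProperties
import Algebra.Properties.Semiring.Exp as Exponentiation
import Algebra.Properties.Semiring.Mult.TCOptimised as Multiples
import Algebra.Properties.Semiring.Sum as SemiringSum
import Algebra.Solver.Ring as RingSolver
open import Algebra.Solver.Ring.AlmostCommutativeRing using (fromCommutativeRing; _-Raw-AlmostCommutative⟶_)
open import Data.Fin.Base as Fin using (Fin; zero; suc; toℕ; finToFun; funToFin)
import Data.Fin.Properties as Fin
open import Data.Integer.Base as ℤ using (ℤ; +_; -[1+_])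
import Data.Integer.Properties as ℤ
open import Data.List.Base using ([]; _∷_; tabulate; map; allFin)
import Data.List.Extrema as Extrema
open import Data.List.Membership.Propositional using (_∈_)
open import Data.List.Membership.Propositional.Properties using (∈-filter⁺; ∈-filter⁻; ∈-allFin; ∈-map⁺; ∈-map⁻)
open import Data.List.Relation.Unary.All as All using (All; []; _∷_)
import Data.List.Relation.Unary.All.Properties as All
open import Data.List.Relation.Unary.AllPairs using ([]; _∷_)
open import Data.List.Relation.Unary.Any as Any using (Any; here; there)
import Data.List.Relation.Unary.Any.Properties as Any
open import Data.List.Relation.Unary.Unique.Propositional using (Unique)
open import Data.Maybe.Base using (Maybe; just; nothing)
open import Data.Nat.Base as ℕ using (ℕ; zero; suc; z≤n; s≤s; _%_; _/_)
open import Data.Nat.DivMod using (m≡m%n+[m/n]*n; m%n<n; /-monoˡ-≤; m*n/n≡m)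
import Data.Nat.Properties as ℕ
open import Data.Product.Base using (Σ-syntax; ∃-syntax; _×_; _,_; proj₁; proj₂)
open import Data.Sum.Base using (_⊎_; inj₁; inj₂)
open import Data.Sum.Properties using (inj₁-injective)
open import Defs
open import Level using (0ℓ)
open import Relation.Binary.Bundles using (TotalOrder)
open import Relation.Binary.Construct.Closure.ReflexiveTransitive using (ε; _◅_)
import Relation.Binary.Construct.NonStrictToStrict as NonStrictToStrict
open import Relation.Binary.PropositionalEquality as ≡ using (_≡_; _≢_)
import Relation.Binary.Reasoning.PartialOrder as PosetReasoning
import Relation.Binary.Reasoning.Setoid as SetoidReasoning
open import Relation.Binary.Structures using (IsDecTotalOrder)
open import Relation.Nullary using (yes; no; ¬_; Dec; contradiction)
open import Relation.Unary using (Pred)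

-- The Bellman operator need not contract in the maximum norm: a single weight `α e` may exceed 1,
-- and only the products around cycles are known to be smaller than 1. So its fixed point is not
-- found by iterating it, but by a finite search over policies. For a fixed policy every orbit is a
-- lasso, a stem followed by a cycle that repeats forever, and one turn of the cycle does contract.
-- All limits that occur are therefore limits of sequences that shrink by a constant ratio once per
-- period, and they can be written down explicitly as the fixed point of one turn. The linear system
-- of a policy needs no matrix inversion: for one right-hand side it is solved by the series along
-- each orbit, and superposing the solutions for unit vectors gives the affine form in `y`. The two
-- kinds of inequalities defining `𝒪` correspond to the two defining `𝒞`: those at unmarked nodes
-- become `y ≥ 0`, those at marked nodes become the inequalities over walks.

-- A ring solver with integer coefficients.

module IntegerCoefficients (R : CommutativeRing 0ℓ 0ℓ) where
  open CommutativeRing R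
  open RingProperties ring
  open Multiples semiring using (1+×; ×-homo-+; ×1-homo-*) renaming (_×_ to _•_)
  open SetoidReasoning setoid

  -- With these multiples `⟦ + 1 ⟧ᶻ` reduces to `1#` itself, not to `1# + 0#`, so constants of the
  -- solver match those in the goals definitionally.
  ⟦_⟧ᶻ : ℤ → Carrier
  ⟦ + n ⟧ᶻ      = n • 1#
  ⟦ -[1+ n ] ⟧ᶻ = - (suc n • 1#)

  cancel-1+ : ∀ x y → (1# + x) - (1# + y) ≈ x - y
  cancel-1+ x y = begin
    (1# + x) + - (1# + y)     ≈⟨ +-cong (+-comm 1# x) (sym (-‿+-comm 1# y)) ⟩
    (x + 1#) + (- 1# + - y)   ≈⟨ +-assoc x 1# _ ⟩
    x + (1# + (- 1# + - y))   ≈⟨ +-congˡ (+-assoc 1# _ _) ⟨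
    x + ((1# + - 1#) + - y)   ≈⟨ +-congˡ (+-congʳ (-‿inverseʳ 1#)) ⟩
    x + (0# + - y)            ≈⟨ +-congˡ (+-identityˡ _) ⟩
    x - y                     ∎

  ⊖-homo : ∀ m n → ⟦ m ℤ.⊖ n ⟧ᶻ ≈ m • 1# - n • 1#
  ⊖-homo m       zero    = sym (trans (+-congˡ -0#≈0#) (+-identityʳ _))
  ⊖-homo zero    (suc n) = sym (+-identityˡ _)
  ⊖-homo (suc m) (suc n) = begin
    ⟦ suc m ℤ.⊖ suc n ⟧ᶻ            ≡⟨ ≡.cong ⟦_⟧ᶻ (ℤ.[1+m]⊖[1+n]≡m⊖n m n) ⟩
    ⟦ m ℤ.⊖ n ⟧ᶻ                    ≈⟨ ⊖-homo m n ⟩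
    m • 1# - n • 1#                 ≈⟨ cancel-1+ _ _ ⟨
    (1# + m • 1#) - (1# + n • 1#)   ≈⟨ +-cong (1+× m 1#) (-‿cong (1+× n 1#)) ⟨
    suc m • 1# - suc n • 1#         ∎

  +-homoᶻ : ∀ i j → ⟦ i ℤ.+ j ⟧ᶻ ≈ ⟦ i ⟧ᶻ + ⟦ j ⟧ᶻ
  +-homoᶻ (+ m)      (+ n)      = ×-homo-+ 1# m n
  +-homoᶻ (+ m)      -[1+ n ]   = ⊖-homo m (suc n)
  +-homoᶻ -[1+ m ]   (+ n)      = trans (⊖-homo n (suc m)) (+-comm _ _)
  +-homoᶻ -[1+ m ]   -[1+ n ]   = begin
    - (suc (suc (m ℕ.+ n)) • 1#)         ≈⟨ -‿cong (1+× (suc (m ℕ.+ n)) 1#) ⟩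
    - (1# + suc (m ℕ.+ n) • 1#)          ≈⟨ -‿cong (+-congˡ (×-homo-+ 1# (suc m) n)) ⟩
    - (1# + (suc m • 1# + n • 1#))       ≈⟨ -‿cong (+-congˡ (+-comm _ _)) ⟩
    - (1# + (n • 1# + suc m • 1#))       ≈⟨ -‿cong (+-assoc _ _ _) ⟨
    - ((1# + n • 1#) + suc m • 1#)       ≈⟨ -‿cong (+-congʳ (1+× n 1#)) ⟨
    - (suc n • 1# + suc m • 1#)          ≈⟨ -‿cong (+-comm _ _) ⟩
    - (suc m • 1# + suc n • 1#)          ≈⟨ -‿+-comm _ _ ⟨
    - (suc m • 1#) - suc n • 1#          ∎

  -‿homoᶻ : ∀ i → ⟦ ℤ.- i ⟧ᶻ ≈ - ⟦ i ⟧ᶻ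
  -‿homoᶻ (+ zero)   = sym -0#≈0#
  -‿homoᶻ (+ suc n)  = refl
  -‿homoᶻ -[1+ n ]   = sym (-‿involutive _)

  *-homoᶻ⁺ : ∀ m j → ⟦ + m ℤ.* j ⟧ᶻ ≈ (m • 1#) * ⟦ j ⟧ᶻ
  *-homoᶻ⁺ m (+ n)    = trans (reflexive (≡.cong ⟦_⟧ᶻ (≡.sym (ℤ.pos-* m n)))) (×1-homo-* m n)
  *-homoᶻ⁺ m -[1+ n ] = begin
    ⟦ + m ℤ.* -[1+ n ] ⟧ᶻ            ≡⟨ ≡.cong ⟦_⟧ᶻ (ℤ.neg-distribʳ-* (+ m) (+ suc n)) ⟨
    ⟦ ℤ.- (+ m ℤ.* + suc n) ⟧ᶻ       ≈⟨ -‿homoᶻ (+ m ℤ.* + suc n) ⟩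
    - ⟦ + m ℤ.* + suc n ⟧ᶻ           ≈⟨ -‿cong (*-homoᶻ⁺ m (+ suc n)) ⟩
    - ((m • 1#) * (suc n • 1#))      ≈⟨ -‿distribʳ-* _ _ ⟩
    (m • 1#) * - (suc n • 1#)        ∎

  *-homoᶻ : ∀ i j → ⟦ i ℤ.* j ⟧ᶻ ≈ ⟦ i ⟧ᶻ * ⟦ j ⟧ᶻ
  *-homoᶻ (+ m)    j = *-homoᶻ⁺ m j
  *-homoᶻ -[1+ m ] j = begin
    ⟦ -[1+ m ] ℤ.* j ⟧ᶻ          ≡⟨ ≡.cong ⟦_⟧ᶻ (ℤ.neg-distribˡ-* (+ suc m) j) ⟨
    ⟦ ℤ.- (+ suc m ℤ.* j) ⟧ᶻ     ≈⟨ -‿homoᶻ (+ suc m ℤ.* j) ⟩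
    - ⟦ + suc m ℤ.* j ⟧ᶻ         ≈⟨ -‿cong (*-homoᶻ⁺ (suc m) j) ⟩
    - ((suc m • 1#) * ⟦ j ⟧ᶻ)    ≈⟨ -‿distribˡ-* _ _ ⟩
    - (suc m • 1#) * ⟦ j ⟧ᶻ      ∎

  morphism : ℤ.+-*-rawRing -Raw-AlmostCommutative⟶ fromCommutativeRing R
  morphism = record
    { ⟦_⟧    = ⟦_⟧ᶻ
    ; +-homo = +-homoᶻ
    ; *-homo = *-homoᶻ
    ; -‿homo = -‿homoᶻ
    ; 0-homo = refl
    ; 1-homo = refl
    }

  -- Integers serve as coefficients because their equality test computes, whereas that of an
  -- axiomatically given field does not.
  equal? : ∀ i j → Maybe (⟦ i ⟧ᶻ ≈ ⟦ j ⟧ᶻ)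
  equal? i j with i ℤ.≟ j
  ... | yes ≡.refl = just refl
  ... | no  _      = nothing

  open RingSolver ℤ.+-*-rawRing (fromCommutativeRing R) morphism equal? public
    using (solve; _:+_; _:*_; _:-_; :-_; _:=_; con)

-- Ordered fields and absolute values.

module OrderedField (ℝ : RealNumbers) where
  open RealNumbers ℝ public hiding (zero)
  open IntegerCoefficients commutativeRing public
    using (solve; _:+_; _:*_; _:-_; :-_; _:=_; con)
  open IsDecTotalOrder isDecTotalOrder public
    using (_≟_; _≤?_; antisym; total; ≤-respˡ-≈; ≤-respʳ-≈)
    renaming (refl to ≤-refl; trans to ≤-trans; reflexive to ≤-reflexive)
  open SemiringSum semiring public using (sum-cong-≋; *-distribˡ-sum; ∑-distrib-+; sum-replicate-zero)

  module ≤-Reasoning where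
    open PosetReasoning (TotalOrder.poset totalOrder) public hiding (start)

  private module O = NonStrictToStrict _≈_ _≤_
  private module M = NaturalMax totalOrder

  <⇒≤ : ∀ {x y} → x < y → x ≤ y
  <⇒≤ = proj₁

  <-≤-trans : ∀ {x y z} → x < y → y ≤ z → x < z
  <-≤-trans = O.<-≤-trans sym ≤-trans antisym ≤-respʳ-≈

  ≤-<-trans : ∀ {x y z} → x ≤ y → y < z → x < z
  ≤-<-trans = O.≤-<-trans ≤-trans antisym ≤-respˡ-≈

  <-respʳ-≈ : ∀ {x y z} → y ≈ z → x < y → x < z
  <-respʳ-≈ y≈z x<y = <-≤-trans x<y (≤-reflexive y≈z)

  <⇒≱ : ∀ {x y} → x < y → ¬ y ≤ x
  <⇒≱ (x≤y , x≉y) y≤x = x≉y (antisym x≤y y≤x)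

  ≰⇒> : ∀ {x y} → ¬ x ≤ y → y < x
  ≰⇒> {x} {y} x≰y with total x y
  ... | inj₁ x≤y = contradiction x≤y x≰y
  ... | inj₂ y≤x = y≤x , λ y≈x → x≰y (≤-reflexive (sym y≈x))

  +-mono-≤ : ∀ {x y u v} → x ≤ y → u ≤ v → x + u ≤ y + v
  +-mono-≤ {x} {y} {u} {v} x≤y u≤v = begin
    x + u ≤⟨ +-monoˡ-≤ u x≤y ⟩
    y + u ≈⟨ +-comm y u ⟩
    u + y ≤⟨ +-monoˡ-≤ y u≤v ⟩
    v + y ≈⟨ +-comm v y ⟩
    y + v ∎
    where open ≤-Reasoning

  +-monoʳ-≤ : ∀ z {x y} → x ≤ y → z + x ≤ z + y
  +-monoʳ-≤ z x≤y = +-mono-≤ ≤-refl x≤y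

  x≤y⇒0≤y-x : ∀ {x y} → x ≤ y → 0# ≤ y - x
  x≤y⇒0≤y-x {x} {y} x≤y = ≤-respˡ-≈ (-‿inverseʳ x) (+-monoˡ-≤ (- x) x≤y)

  +-nonNeg : ∀ {x y} → 0# ≤ x → 0# ≤ y → 0# ≤ x + y
  +-nonNeg 0≤x 0≤y = ≤-respˡ-≈ (+-identityˡ 0#) (+-mono-≤ 0≤x 0≤y)

  ≤-from-difference : ∀ {x y d} → 0# ≤ d → y ≈ x + d → x ≤ y
  ≤-from-difference {x} {y} {d} 0≤d y≈x+d = begin
    x      ≈⟨ +-identityʳ x ⟨
    x + 0# ≤⟨ +-monoʳ-≤ x 0≤d ⟩
    x + d  ≈⟨ y≈x+d ⟨
    y      ∎
    where open ≤-Reasoning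

  0≤y-x⇒x≤y : ∀ {x y} → 0# ≤ y - x → x ≤ y
  0≤y-x⇒x≤y {x} {y} 0≤y-x = ≤-from-difference 0≤y-x (solve 2 (λ x y → y := x :+ (y :- x)) refl x y)

  *-monoˡ-≤ : ∀ {x y z} → 0# ≤ z → x ≤ y → z * x ≤ z * y
  *-monoˡ-≤ {x} {y} {z} 0≤z x≤y = ≤-from-difference (*-nonNeg 0≤z (x≤y⇒0≤y-x x≤y))
    (solve 3 (λ x y z → z :* y := z :* x :+ z :* (y :- x)) refl x y z)

  *-monoʳ-≤ : ∀ {x y z} → 0# ≤ z → x ≤ y → x * z ≤ y * z
  *-monoʳ-≤ {x} {y} {z} 0≤z x≤y = ≤-from-difference (*-nonNeg (x≤y⇒0≤y-x x≤y) 0≤z)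
    (solve 3 (λ x y z → y :* z := x :* z :+ (y :- x) :* z) refl x y z)

  0≤1 : 0# ≤ 1#
  0≤1 with total 0# 1#
  ... | inj₁ 0≤1′ = 0≤1′
  ... | inj₂ 1≤0  = ≤-respʳ-≈ (solve 0 ((con (+ 0) :- con (+ 1)) :* (con (+ 0) :- con (+ 1)) := con (+ 1)) refl)
                              (*-nonNeg (x≤y⇒0≤y-x 1≤0) (x≤y⇒0≤y-x 1≤0))

  0<1 : 0# < 1#
  0<1 = 0≤1 , 0≉1

  *-cancel-≈0 : ∀ {x y} → ¬ x ≈ 0# → x * y ≈ 0# → y ≈ 0#
  *-cancel-≈0 {x} {y} x≉0 xy≈0 with inverse x x≉0
  ... | x⁻¹ , xx⁻¹≈1 = trans (sym (*-identityˡ y)) (trans (*-congʳ (sym xx⁻¹≈1))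
        (trans (solve 3 (λ x y z → (x :* z) :* y := z :* (x :* y)) refl x y x⁻¹)
        (trans (*-congˡ xy≈0) (zeroʳ x⁻¹))))

  *-pos : ∀ {x y} → 0# < x → 0# < y → 0# < x * y
  *-pos (0≤x , 0≉x) (0≤y , 0≉y) =
    *-nonNeg 0≤x 0≤y , λ 0≈xy → 0≉y (sym (*-cancel-≈0 (λ x≈0 → 0≉x (sym x≈0)) (sym 0≈xy)))

  +-nonNeg-pos : ∀ {x y} → 0# ≤ x → 0# < y → 0# < x + y
  +-nonNeg-pos {x} {y} 0≤x 0<y = <-≤-trans 0<y (≤-from-difference 0≤x (+-comm x y))

  x<y⇒0<y-x : ∀ {x y} → x < y → 0# < y - x
  x<y⇒0<y-x {x} {y} (x≤y , x≉y) = x≤y⇒0≤y-x x≤y , λ 0≈y-x → x≉y (trans (sym (+-identityʳ x))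
    (trans (+-congˡ 0≈y-x) (solve 2 (λ x y → x :+ (y :- x) := y) refl x y)))

  <-from-difference : ∀ {x y d} → 0# < d → y ≈ x + d → x < y
  <-from-difference {x} {y} {d} (0≤d , 0≉d) y≈x+d = ≤-from-difference 0≤d y≈x+d , λ x≈y →
    0≉d (trans (sym (-‿inverseʳ x)) (trans (+-congʳ (trans x≈y y≈x+d))
      (solve 2 (λ x d → (x :+ d) :- x := d) refl x d)))

  +-monoˡ-< : ∀ z {x y} → x < y → x + z < y + z
  +-monoˡ-< z {x} {y} x<y = <-from-difference (x<y⇒0<y-x x<y)
    (solve 3 (λ x y z → y :+ z := (x :+ z) :+ (y :- x)) refl x y z)

  positive-inverse : ∀ {x} → 0# < x → ∃[ y ] (0# < y × x * y ≈ 1#)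
  positive-inverse {x} 0<x@(0≤x , 0≉x) with inverse x (λ x≈0 → 0≉x (sym x≈0))
  ... | y , xy≈1 with 0# ≤? y
  ...   | yes 0≤y = y , (0≤y , λ 0≈y → 0≉1 (trans (sym (zeroʳ x)) (trans (*-congˡ 0≈y) xy≈1))) , xy≈1
  -- If `y` were negative, the nonnegative number `x * (0# - y)` would equal `- 1#`, so that
  -- `1# ≤ 0#`.
  ...   | no  0≰y = contradiction
          (≤-from-difference (*-nonNeg 0≤x (x≤y⇒0≤y-x (<⇒≤ (≰⇒> 0≰y))))
            (trans (solve 2 (λ x y → con (+ 0) := (x :* y) :+ x :* (con (+ 0) :- y)) refl x y)
              (+-congʳ xy≈1)))
          (<⇒≱ 0<1)

  x≤∣x∣ : ∀ x → x ≤ ∣ x ∣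
  x≤∣x∣ x = M.x≤x⊔y x (- x)

  -x≤∣x∣ : ∀ x → - x ≤ ∣ x ∣
  -x≤∣x∣ x = M.x≤y⊔x x (- x)

  ∣x∣≤ : ∀ {x y} → x ≤ y → - x ≤ y → ∣ x ∣ ≤ y
  ∣x∣≤ = M.⊔-lub

  ∣x∣-nonNeg : ∀ x → 0# ≤ ∣ x ∣
  ∣x∣-nonNeg x with total 0# x
  ... | inj₁ 0≤x = ≤-trans 0≤x (x≤∣x∣ x)
  ... | inj₂ x≤0 = ≤-trans (≤-respʳ-≈ (+-identityˡ _) (x≤y⇒0≤y-x x≤0)) (-x≤∣x∣ x)

  ∣∣-cong : ∀ {x y} → x ≈ y → ∣ x ∣ ≈ ∣ y ∣
  ∣∣-cong x≈y = M.⊔-cong x≈y (-‿cong x≈y)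

  ∣x+y∣≤ : ∀ x y → ∣ x + y ∣ ≤ ∣ x ∣ + ∣ y ∣
  ∣x+y∣≤ x y = ∣x∣≤ (+-mono-≤ (x≤∣x∣ x) (x≤∣x∣ y))
    (≤-respˡ-≈ (solve 2 (λ x y → (:- x) :+ (:- y) := :- (x :+ y)) refl x y)
      (+-mono-≤ (-x≤∣x∣ x) (-x≤∣x∣ y)))

  ∣x*y∣≤ : ∀ {x y z} → 0# ≤ x → ∣ y ∣ ≤ z → ∣ x * y ∣ ≤ x * z
  ∣x*y∣≤ {x} {y} 0≤x ∣y∣≤z = ∣x∣≤
    (*-monoˡ-≤ 0≤x (≤-trans (x≤∣x∣ y) ∣y∣≤z))
    (≤-respˡ-≈ (solve 2 (λ x y → x :* (:- y) := :- (x :* y)) refl x y)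
      (*-monoˡ-≤ 0≤x (≤-trans (-x≤∣x∣ y) ∣y∣≤z)))

  ∣-x∣≈∣x∣ : ∀ x → ∣ - x ∣ ≈ ∣ x ∣
  ∣-x∣≈∣x∣ x = antisym
    (∣x∣≤ (-x≤∣x∣ x) (≤-respˡ-≈ (solve 1 (λ x → x := :- (:- x)) refl x) (x≤∣x∣ x)))
    (∣x∣≤ (≤-respˡ-≈ (solve 1 (λ x → :- (:- x) := x) refl x) (-x≤∣x∣ (- x))) (x≤∣x∣ (- x)))

  ∣x∣≤0⇒x≈0 : ∀ {x} → ∣ x ∣ ≤ 0# → x ≈ 0#
  ∣x∣≤0⇒x≈0 {x} ∣x∣≤0 = antisym (≤-trans (x≤∣x∣ x) ∣x∣≤0)
    (≤-from-difference (x≤y⇒0≤y-x (≤-trans (-x≤∣x∣ x) ∣x∣≤0))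
      (solve 1 (λ x → x := con (+ 0) :+ (con (+ 0) :- (:- x))) refl x))

  ∣x*y∣≤∣x∣*z : ∀ x {y z} → ∣ y ∣ ≤ z → ∣ x * y ∣ ≤ ∣ x ∣ * z
  ∣x*y∣≤∣x∣*z x {y} {z} ∣y∣≤z with total 0# x
  ... | inj₁ 0≤x = ≤-trans (∣x*y∣≤ 0≤x ∣y∣≤z)
                     (*-monoʳ-≤ (≤-trans (∣x∣-nonNeg y) ∣y∣≤z) (x≤∣x∣ x))
  ... | inj₂ x≤0 = ≤-trans
    (≤-respˡ-≈ (∣∣-cong (solve 2 (λ x y → (:- x) :* (:- y) := x :* y) refl x y))
      (∣x*y∣≤ {y = - y} 0≤-x (≤-respˡ-≈ (sym (∣-x∣≈∣x∣ y)) ∣y∣≤z)))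
    (*-monoʳ-≤ (≤-trans (∣x∣-nonNeg y) ∣y∣≤z) (-x≤∣x∣ x))
    where
    0≤-x : 0# ≤ - x
    0≤-x = ≤-respʳ-≈ (+-identityˡ _) (x≤y⇒0≤y-x x≤0)

  x*inverse-cancel : ∀ x {y y⁻¹} → y * y⁻¹ ≈ 1# → y * (y⁻¹ * x) ≈ x
  x*inverse-cancel x {y} {y⁻¹} yy⁻¹≈1 =
    trans (sym (*-assoc y y⁻¹ x)) (trans (*-congʳ yy⁻¹≈1) (*-identityˡ x))

-- Affine and piecewise-linear maps.

module PiecewiseLinear (ℝ : RealNumbers) where
  open OrderedField ℝ
  open AffineForm

  -- The form is kept as data, so that the closure lemmas below assemble the forms of a piece by
  -- following the formula of the function.
  IsAffine : ∀ {n} → (Point ℝ n → Carrier) → Set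
  IsAffine {n} g = Σ[ h ∈ AffineForm ℝ n ] (∀ x → eval h x ≈ g x)

  affine-resp-≈ : ∀ {n} {f g : Point ℝ n → Carrier} → (∀ x → f x ≈ g x) → IsAffine f → IsAffine g
  affine-resp-≈ f≈g (h , h≈f) = h , λ x → trans (h≈f x) (f≈g x)

  affine-constant : ∀ {n} a → IsAffine {n} (λ _ → a)
  affine-constant {n} a =
    record { coefficient = λ _ → 0# ; constant = a } , λ x →
    trans (+-congʳ (trans (sum-cong-≋ {n} (λ i → zeroˡ (x i))) (sum-replicate-zero n))) (+-identityˡ a)

  affine-+ : ∀ {n} {f g : Point ℝ n → Carrier} → IsAffine f → IsAffine g → IsAffine (λ x → f x + g x)
  affine-+ {n} (h , h≈f) (k , k≈g) =
    record { coefficient = λ i → coefficient h i + coefficient k i ; constant = constant h + constant k } , λ x →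
    trans (+-congʳ (trans (sum-cong-≋ {n} (λ i → distribʳ (x i) (coefficient h i) (coefficient k i)))
                          (∑-distrib-+ (λ i → coefficient h i * x i) (λ i → coefficient k i * x i))))
    (trans (solve 4 (λ a b c d → (a :+ b) :+ (c :+ d) := (a :+ c) :+ (b :+ d)) refl
              (sum (λ i → coefficient h i * x i)) (sum (λ i → coefficient k i * x i)) (constant h) (constant k))
           (+-cong (h≈f x) (k≈g x)))

  affine-* : ∀ {n} {f : Point ℝ n → Carrier} a → IsAffine f → IsAffine (λ x → a * f x)
  affine-* {n} a (h , h≈f) =
    record { coefficient = λ i → a * coefficient h i ; constant = a * constant h } , λ x →
    trans (+-congʳ (trans (sum-cong-≋ {n} (λ i → *-assoc a (coefficient h i) (x i)))
                          (sym (*-distribˡ-sum a (λ i → coefficient h i * x i)))))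
    (trans (sym (distribˡ a _ _)) (*-congˡ (h≈f x)))

  affine-difference : ∀ {n} {f g : Point ℝ n → Carrier} → IsAffine f → IsAffine g → IsAffine (λ x → f x - g x)
  affine-difference {f = f} {g} F G = affine-resp-≈
    (λ x → solve 2 (λ a b → a :+ con -[1+ 0 ] :* b := a :- b) refl (f x) (g x))
    (affine-+ F (affine-* (- 1#) G))

  indicator : ∀ {n} → Fin n → Fin n → Carrier
  indicator zero    zero    = 1#
  indicator zero    (suc j) = 0#
  indicator (suc i) zero    = 0#
  indicator (suc i) (suc j) = indicator i j

  sum-indicator : ∀ {n} (i : Fin n) (x : Point ℝ n) → sum (λ j → indicator i j * x j) ≈ x i
  sum-indicator {suc n} zero x = trans
    (+-cong (*-identityˡ _) (trans (sum-cong-≋ {n} (λ j → zeroˡ (x (suc j)))) (sum-replicate-zero n)))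
    (+-identityʳ _)
  sum-indicator (suc i) x = trans (+-cong (zeroˡ _) (sum-indicator i (λ j → x (suc j)))) (+-identityˡ _)

  affine-coordinate : ∀ {n} (i : Fin n) → IsAffine (λ x → x i)
  affine-coordinate i =
    record { coefficient = indicator i ; constant = 0# } , λ x →
    trans (+-identityʳ _) (sum-indicator i x)

  -- The neighbourhood filter of `x`. Its closure under finite intersections replaces explicit
  -- minima of radii.
  Near : ∀ {n} → Point ℝ n → (Point ℝ n → Set) → Set
  Near x Q = ∃[ δ ] (0# < δ × (∀ x′ → (∀ i → ∣ x′ i - x i ∣ < δ) → Q x′))

  module _ {n : ℕ} {x : Point ℝ n} where

    near-map : ∀ {Q R : Point ℝ n → Set} → (∀ x′ → Q x′ → R x′) → Near x Q → Near x R
    near-map Q⇒R (δ , 0<δ , q) = δ , 0<δ , λ x′ close → Q⇒R x′ (q x′ close)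

    near-× : ∀ {Q R : Point ℝ n → Set} → Near x Q → Near x R → Near x (λ x′ → Q x′ × R x′)
    near-× (δ , 0<δ , q) (γ , 0<γ , r) with total δ γ
    ... | inj₁ δ≤γ = δ , 0<δ , λ x′ close → q x′ close , r x′ (λ i → <-≤-trans (close i) δ≤γ)
    ... | inj₂ γ≤δ = γ , 0<γ , λ x′ close → q x′ (λ i → <-≤-trans (close i) γ≤δ) , r x′ close

    near-∀ : ∀ {m} {Q : Fin m → Point ℝ n → Set} → (∀ j → Near x (Q j)) → Near x (λ x′ → ∀ j → Q j x′)
    near-∀ {zero}  _  = 1# , 0<1 , λ _ _ ()
    near-∀ {suc m} qs = near-map (λ { _ (q , _) zero → q ; _ (_ , q) (suc j) → q j })
                                 (near-× (qs zero) (near-∀ (λ j → qs (suc j))))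

    near-All : ∀ {B : Set} {Q : B → Point ℝ n → Set} {bs} →
               All (λ b → Near x (Q b)) bs → Near x (λ x′ → All (λ b → Q b x′) bs)
    near-All []       = 1# , 0<1 , λ _ _ → []
    near-All (q ∷ qs) = near-map (λ { _ (p , ps) → p ∷ ps }) (near-× q (near-All qs))

  ∑-difference-bound : ∀ n (a x x′ : Point ℝ n) {δ} → (∀ i → ∣ x′ i - x i ∣ ≤ δ) →
    ∣ sum (λ i → a i * x′ i) - sum (λ i → a i * x i) ∣ ≤ sum (λ i → ∣ a i ∣) * δ
  ∑-difference-bound zero a x x′ {δ} close =
    ∣x∣≤ (≤-reflexive (solve 1 (λ δ → con (+ 0) :- con (+ 0) := con (+ 0) :* δ) refl δ))
         (≤-reflexive (solve 1 (λ δ → :- (con (+ 0) :- con (+ 0)) := con (+ 0) :* δ) refl δ))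
  ∑-difference-bound (suc n) a x x′ {δ} close = begin
    ∣ (a₀ * x₀′ + s′) - (a₀ * x₀ + s) ∣
      ≈⟨ ∣∣-cong (solve 5 (λ a x′ x s′ s → (a :* x′ :+ s′) :- (a :* x :+ s) := a :* (x′ :- x) :+ (s′ :- s))
                          refl a₀ x₀′ x₀ s′ s) ⟩
    ∣ a₀ * (x₀′ - x₀) + (s′ - s) ∣
      ≤⟨ ∣x+y∣≤ _ _ ⟩
    ∣ a₀ * (x₀′ - x₀) ∣ + ∣ s′ - s ∣
      ≤⟨ +-mono-≤ (∣x*y∣≤∣x∣*z a₀ (close zero))
                  (∑-difference-bound n (λ i → a (suc i)) _ _ (λ i → close (suc i))) ⟩
    ∣ a₀ ∣ * δ + sum (λ i → ∣ a (suc i) ∣) * δ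
      ≈⟨ distribʳ δ _ _ ⟨
    (∣ a₀ ∣ + sum (λ i → ∣ a (suc i) ∣)) * δ
      ∎
    where
    open ≤-Reasoning
    a₀ = a zero ; x₀ = x zero ; x₀′ = x′ zero
    s′ = sum (λ i → a (suc i) * x′ (suc i)) ; s = sum (λ i → a (suc i) * x (suc i))

  sum-nonNeg : ∀ {n} (x : Point ℝ n) → (∀ i → 0# ≤ x i) → 0# ≤ sum x
  sum-nonNeg {zero}  x 0≤x = ≤-refl
  sum-nonNeg {suc n} x 0≤x = +-nonNeg (0≤x zero) (sum-nonNeg (λ i → x (suc i)) (λ i → 0≤x (suc i)))

  eval-continuous : ∀ {n} (h : AffineForm ℝ n) x η → 0# < η →
                    Near x (λ x′ → ∣ eval h x′ - eval h x ∣ < η)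
  eval-continuous {n} h x η 0<η = δ , 0<δ , λ x′ close → ≤-<-trans (bound x′ close) Kδ<η
    where
    a = coefficient h
    K = sum (λ i → ∣ a i ∣)
    -- Dividing `η` by `K + 1#` instead of `K` permits `K` to vanish and leaves room for a strict
    -- inequality.
    1+K⁻¹ = positive-inverse (+-nonNeg-pos (sum-nonNeg _ (λ i → ∣x∣-nonNeg (a i))) 0<1)
    δ = proj₁ 1+K⁻¹ * η
    0<δ : 0# < δ
    0<δ = *-pos (proj₁ (proj₂ 1+K⁻¹)) 0<η
    Kδ<η : K * δ < η
    Kδ<η = <-from-difference 0<δ (trans (sym (x*inverse-cancel η (proj₂ (proj₂ 1+K⁻¹))))
             (solve 2 (λ K δ → (K :+ con (+ 1)) :* δ := K :* δ :+ δ) refl K δ))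
    bound : ∀ x′ → (∀ i → ∣ x′ i - x i ∣ < δ) → ∣ eval h x′ - eval h x ∣ ≤ K * δ
    bound x′ close = ≤-respˡ-≈
      (∣∣-cong (solve 3 (λ s′ s c → s′ :- s := (s′ :+ c) :- (s :+ c)) refl
                 (sum (λ i → a i * x′ i)) (sum (λ i → a i * x i)) (constant h)))
      (∑-difference-bound n a x x′ (λ i → <⇒≤ (close i)))

  near-outside : ∀ {n} (H : Polyhedron ℝ n) {x} → ¬ InPolyhedron ℝ H x → Near x (λ x′ → ¬ InPolyhedron ℝ H x′)
  near-outside []      x∉ = contradiction [] x∉
  near-outside (h ∷ H) {x} x∉ with 0# ≤? eval h x
  ... | yes 0≤h = near-map (λ { _ x′∉ (_ ∷ x′∈) → x′∉ x′∈ }) (near-outside H (λ x∈ → x∉ (0≤h ∷ x∈)))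
  ... | no  0≰h = near-map
    (λ { x′ close (0≤h′ ∷ _) → <⇒≱ close (≤-trans
           (≤-from-difference 0≤h′ (solve 2 (λ a b → b :- a := (con (+ 0) :- a) :+ b) refl (eval h x) (eval h x′)))
           (x≤∣x∣ _)) })
    -- The tolerance is the amount by which `x` violates the inequality: a change smaller than that
    -- keeps the form negative.
    (eval-continuous h x (0# - eval h x) (x<y⇒0<y-x (≰⇒> 0≰h)))

  -- Near x the function is given by the affine maps of the pieces containing x:
  -- the other pieces are closed, hence stay away from x.
  piecewiseLinear⇒continuous : ∀ {n m} {P : Pred (Point ℝ n) 0ℓ} {f : Point ℝ n → Point ℝ m} →
                               PiecewiseLinearOn ℝ P f → ContinuousOn ℝ P f
  piecewiseLinear⇒continuous {n} {m} {P} {f} (pieces , covers , agrees) x Px η 0<η =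
    let (δ , 0<δ , close) = near-All (All.map nearPiece agrees)
    in δ , 0<δ , λ x′ Px′ x′≈x → conclude x′ Px′ (covers x′ Px′) (close x′ x′≈x)
    where
    Close : Point ℝ n → Set
    Close x′ = ∀ j → ∣ f x′ j - f x j ∣ < η

    nearPiece : ∀ {piece : Polyhedron ℝ n × (Fin m → AffineForm ℝ n)} →
      (∀ x′ → P x′ → InPolyhedron ℝ (proj₁ piece) x′ → ∀ j → f x′ j ≈ eval (proj₂ piece j) x′) →
      Near x (λ x′ → P x′ → InPolyhedron ℝ (proj₁ piece) x′ → Close x′)
    nearPiece {H , g} f≈g with All.all? (λ h → 0# ≤? eval h x) H
    ... | yes x∈H = near-map
      (λ x′ close Px′ x′∈H j → ≤-<-trans
         (≤-reflexive (∣∣-cong (+-cong (f≈g x′ Px′ x′∈H j) (-‿cong (f≈g x Px x∈H j))))) (close j))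
      (near-∀ (λ j → eval-continuous (g j) x η 0<η))
    ... | no  x∉H = near-map (λ x′ x′∉H _ x′∈H → contradiction x′∈H x′∉H) (near-outside H x∉H)

    conclude : ∀ x′ → P x′ → ∀ {ps} → Any (λ piece → InPolyhedron ℝ (proj₁ piece) x′) ps →
               All (λ piece → P x′ → InPolyhedron ℝ (proj₁ piece) x′ → Close x′) ps → Close x′
    conclude x′ Px′ (here x′∈H) (close ∷ _)   = close Px′ x′∈H
    conclude x′ Px′ (there x′∈) (_ ∷ closes) = conclude x′ Px′ x′∈ closes

  -- The common shape of both piecewise-linearity proofs: `i` ranges over codes of policies, `l`
  -- over edges, and candidate `g i` is valid where all its slacks are nonnegative.
  finite-piecewiseLinear : ∀ {N k n m} {P : Pred (Point ℝ n) 0ℓ} {f : Point ℝ n → Point ℝ m}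
    (slack : Fin N → Fin k → Point ℝ n → Carrier) (g : Fin N → Point ℝ n → Point ℝ m) →
    (∀ i l → IsAffine (slack i l)) → (∀ i j → IsAffine (λ x → g i x j)) →
    (∀ x → P x → ∃[ i ] (∀ l → 0# ≤ slack i l x)) →
    (∀ x → P x → ∀ i → (∀ l → 0# ≤ slack i l x) → ∀ j → f x j ≈ g i x j) →
    PiecewiseLinearOn ℝ P f
  finite-piecewiseLinear slack g slack-affine g-affine covers agrees =
    tabulate (λ i → tabulate (λ l → proj₁ (slack-affine i l)) , λ j → proj₁ (g-affine i j)) ,
    (λ x Px → let (i , 0≤slack) = covers x Px in
       Any.tabulate⁺ i (All.tabulate⁺ (λ l → ≤-respʳ-≈ (sym (proj₂ (slack-affine i l) x)) (0≤slack l)))) ,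
    All.tabulate⁺ (λ i x Px x∈H j → trans
      (agrees x Px i (λ l → ≤-respʳ-≈ (proj₂ (slack-affine i l) x) (All.tabulate⁻ x∈H l)) j)
      (sym (proj₂ (g-affine i j) x)))

-- Geometric decay and limits.

module Sequences (ℝ : RealNumbers) where
  open OrderedField ℝ
  open Exponentiation semiring using (_^_)

  -- For a sequence of the form `s n - l` this unfolds to `ConvergesTo s l`, so either may be used
  -- for the other.
  Vanishes : (ℕ → Carrier) → Set
  Vanishes e = ∀ δ → 0# < δ → ∃[ N ] (∀ n → N ℕ.≤ n → ∣ e n ∣ < δ)

  -- The ratio is gained once per turn of a cycle, not once per step. Writing late indices as
  -- `j ℕ.+ start` avoids side conditions on them.
  record Geometric (e : ℕ → Carrier) : Set where
    field
      ratio        : Carrier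
      start period : ℕ
      0<period     : 0 ℕ.< period
      0≤ratio      : 0# ≤ ratio
      ratio<1      : ratio < 1#
      recurrence   : ∀ j → e (j ℕ.+ start ℕ.+ period) ≈ ratio * e (j ℕ.+ start)

  geometric-* : ∀ x {e} → Geometric e → Geometric (λ k → x * e k)
  geometric-* x {e} G = record
    { Geometric G hiding (recurrence)
    ; recurrence = λ j → trans (*-congˡ (recurrence j))
        (solve 3 (λ x r y → x :* (r :* y) := r :* (x :* y)) refl x ratio (e (j ℕ.+ start)))
    }
    where open Geometric G

  geometric-shift : ∀ {e} → Geometric e → Geometric (λ k → e (suc k))
  geometric-shift G = record { Geometric G hiding (recurrence) ; recurrence = λ j → recurrence (suc j) }
    where open Geometric G

  ^-nonNeg : ∀ {x} → 0# ≤ x → ∀ n → 0# ≤ x ^ n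
  ^-nonNeg 0≤x zero    = 0≤1
  ^-nonNeg 0≤x (suc n) = *-nonNeg 0≤x (^-nonNeg 0≤x n)

  ^-antitone : ∀ {x m n} → 0# ≤ x → x ≤ 1# → m ℕ.≤ n → x ^ n ≤ x ^ m
  ^-antitone {n = zero}  0≤x x≤1 z≤n = ≤-refl
  ^-antitone {x} {n = suc n} 0≤x x≤1 z≤n = begin
    x * x ^ n ≤⟨ *-monoˡ-≤ 0≤x (^-antitone 0≤x x≤1 (z≤n {n})) ⟩
    x * 1#    ≈⟨ *-identityʳ x ⟩
    x         ≤⟨ x≤1 ⟩
    1#        ∎
    where open ≤-Reasoning
  ^-antitone 0≤x x≤1 (s≤s m≤n) = *-monoˡ-≤ 0≤x (^-antitone 0≤x x≤1 m≤n)

  n·1-nonNeg : ∀ n → 0# ≤ n · 1#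
  n·1-nonNeg zero    = ≤-refl
  n·1-nonNeg (suc n) = +-nonNeg 0≤1 (n·1-nonNeg n)

  -- Bernoulli's inequality for 1 / x, multiplied out.
  bernoulli : ∀ {x} → 0# ≤ x → x ≤ 1# → ∀ n → (1# + (n · 1#) * (1# - x)) * x ^ n ≤ 1#
  bernoulli {x} 0≤x x≤1 zero = ≤-reflexive
    (solve 1 (λ x → (con (+ 1) :+ con (+ 0) :* (con (+ 1) :- x)) :* con (+ 1) := con (+ 1)) refl x)
  bernoulli {x} 0≤x x≤1 (suc n) = ≤-from-difference
    (+-nonNeg (x≤y⇒0≤y-x (bernoulli 0≤x x≤1 n))
              (*-nonNeg (*-nonNeg (*-nonNeg (x≤y⇒0≤y-x x≤1) (x≤y⇒0≤y-x x≤1)) (^-nonNeg 0≤x n)) (n·1-nonNeg (suc n))))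
    (solve 3 (λ x k t → let d = con (+ 1) :- x in
        con (+ 1) := (con (+ 1) :+ (con (+ 1) :+ k) :* d) :* (x :* t)
                     :+ ((con (+ 1) :- (con (+ 1) :+ k :* d) :* t) :+ ((d :* d) :* t) :* (con (+ 1) :+ k)))
       refl x (n · 1#) (x ^ n))

  ^-small : ∀ {x} → 0# ≤ x → x < 1# → ∀ M δ → 0# < δ → ∃[ n ] (x ^ n * M < δ)
  ^-small {x} 0≤x x<1 M δ 0<δ = n , tM<δ (t ≟ 0#)
    where
    open ≤-Reasoning
    d    = 1# - x
    d>0  = x<y⇒0<y-x x<1
    -- The exponent is chosen to be at least `M / (d * δ)`, which is what makes Bernoulli's
    -- inequality bound `t * M` by `δ - t * δ`.
    inv  = positive-inverse (*-pos d>0 0<δ)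
    w    = proj₁ inv
    arch = archimedean (w * M)
    n    = proj₁ arch
    t    = x ^ n
    0≤t  = ^-nonNeg 0≤x n

    M≤ : M ≤ (d * δ) * (n · 1#)
    M≤ = begin
      M                   ≈⟨ x*inverse-cancel M (proj₂ (proj₂ inv)) ⟨
      (d * δ) * (w * M)   ≤⟨ *-monoˡ-≤ (<⇒≤ (*-pos d>0 0<δ)) (proj₂ arch) ⟩
      (d * δ) * (n · 1#)  ∎

    tM≤ : t * M ≤ δ - t * δ
    tM≤ = begin
      t * M                        ≤⟨ *-monoˡ-≤ 0≤t M≤ ⟩
      t * ((d * δ) * (n · 1#))     ≈⟨ solve 4 (λ t d δ k → t :* ((d :* δ) :* k) :=
                                        ((con (+ 1) :+ k :* d) :* t) :* δ :- t :* δ) refl t d δ (n · 1#) ⟩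
      ((1# + (n · 1#) * d) * t) * δ - t * δ
                                   ≤⟨ +-monoˡ-≤ _ (*-monoʳ-≤ (<⇒≤ 0<δ) (bernoulli 0≤x (<⇒≤ x<1) n)) ⟩
      1# * δ - t * δ               ≈⟨ +-congʳ (*-identityˡ δ) ⟩
      δ - t * δ                    ∎

    -- The bound `δ - t * δ` is strictly below `δ` only for nonzero `t`, and `x` may be 0, as it is
    -- for the loops added at marked nodes.
    tM<δ : Dec (t ≈ 0#) → t * M < δ
    tM<δ (yes t≈0) = ≤-<-trans (≤-reflexive (trans (*-congʳ t≈0) (zeroˡ M))) 0<δ
    tM<δ (no  t≉0) = ≤-<-trans tM≤ (<-from-difference (*-pos (0≤t , λ 0≈t → t≉0 (sym 0≈t)) 0<δ)
      (solve 2 (λ δ u → δ := (δ :- u) :+ u) refl δ (t * δ)))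

  -- "Below" refers to the indices `r < n`; this gives the bound over one period from which
  -- geometric decay starts.
  bounded-below : ∀ (e : ℕ → Carrier) n → ∃[ M ] (0# ≤ M × (∀ r → r ℕ.< n → ∣ e r ∣ ≤ M))
  bounded-below e zero = 0# , ≤-refl , λ _ ()
  bounded-below e (suc n) with bounded-below e n
  ... | M , 0≤M , bound = M + ∣ e n ∣ , +-nonNeg 0≤M (∣x∣-nonNeg (e n)) , λ r r<1+n → bound′ r (ℕ.m<1+n⇒m<n∨m≡n r<1+n)
    where
    bound′ : ∀ r → r ℕ.< n ⊎ r ≡ n → ∣ e r ∣ ≤ M + ∣ e n ∣
    bound′ r (inj₁ r<n)    = ≤-from-difference (+-nonNeg (x≤y⇒0≤y-x (bound r r<n)) (∣x∣-nonNeg (e n)))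
      (solve 3 (λ a M b → M :+ b := a :+ ((M :- a) :+ b)) refl (∣ e r ∣) M (∣ e n ∣))
    bound′ r (inj₂ ≡.refl) = ≤-from-difference 0≤M (+-comm M (∣ e n ∣))

  -- Division with remainder splits an index past `start` into a position within the first period
  -- and a number of full periods. The position is bounded by `M`, and each full period contributes
  -- a factor `ratio`.
  geometric⇒vanishes : ∀ {e} → Geometric e → Vanishes e
  geometric⇒vanishes {e} G δ 0<δ = K ℕ.* period ℕ.+ start , small
    where
    open Geometric G
    open ≤-Reasoning
    instance
      period-nonZero : ℕ.NonZero period
      period-nonZero = ℕ.>-nonZero 0<period

    bounded = bounded-below (λ r → e (r ℕ.+ start)) period
    M       = proj₁ bounded
    0≤M     = proj₁ (proj₂ bounded)
    decay   = ^-small 0≤ratio ratio<1 M δ 0<δ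
    K       = proj₁ decay

    reindex : ∀ r q → r ℕ.+ (period ℕ.+ q) ℕ.+ start ≡ (r ℕ.+ q) ℕ.+ start ℕ.+ period
    reindex r q = ≡.trans (≡.cong (ℕ._+ start)
        (≡.trans (≡.cong (r ℕ.+_) (ℕ.+-comm period q)) (≡.sym (ℕ.+-assoc r q period))))
      (≡.trans (ℕ.+-assoc (r ℕ.+ q) period start)
      (≡.trans (≡.cong (r ℕ.+ q ℕ.+_) (ℕ.+-comm period start)) (≡.sym (ℕ.+-assoc (r ℕ.+ q) start period))))

    bound : ∀ r → r ℕ.< period → ∀ q → ∣ e (r ℕ.+ q ℕ.* period ℕ.+ start) ∣ ≤ ratio ^ q * M
    bound r r<p zero = begin
      ∣ e (r ℕ.+ 0 ℕ.+ start) ∣ ≡⟨ ≡.cong (λ k → ∣ e (k ℕ.+ start) ∣) (ℕ.+-identityʳ r) ⟩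
      ∣ e (r ℕ.+ start) ∣       ≤⟨ proj₂ (proj₂ bounded) r r<p ⟩
      M                         ≈⟨ *-identityˡ M ⟨
      1# * M                    ∎
    bound r r<p (suc q) = begin
      ∣ e (r ℕ.+ (period ℕ.+ q ℕ.* period) ℕ.+ start) ∣   ≡⟨ ≡.cong (λ k → ∣ e k ∣) (reindex r (q ℕ.* period)) ⟩
      ∣ e (r ℕ.+ q ℕ.* period ℕ.+ start ℕ.+ period) ∣     ≈⟨ ∣∣-cong (recurrence (r ℕ.+ q ℕ.* period)) ⟩
      ∣ ratio * e (r ℕ.+ q ℕ.* period ℕ.+ start) ∣        ≤⟨ ∣x*y∣≤ 0≤ratio (bound r r<p q) ⟩
      ratio * (ratio ^ q * M)                             ≈⟨ *-assoc ratio _ M ⟨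
      ratio ^ suc q * M                                   ∎

    small : ∀ n → K ℕ.* period ℕ.+ start ℕ.≤ n → ∣ e n ∣ < δ
    small n Kp+s≤n = ≤-<-trans (begin
      ∣ e n ∣                                      ≡⟨ ≡.cong (λ k → ∣ e k ∣) n≡ ⟩
      ∣ e (j % period ℕ.+ q ℕ.* period ℕ.+ start) ∣ ≤⟨ bound (j % period) (m%n<n j period) q ⟩
      ratio ^ q * M                                ≤⟨ *-monoʳ-≤ 0≤M (^-antitone 0≤ratio (<⇒≤ ratio<1) K≤q) ⟩
      ratio ^ K * M                                ∎) (proj₂ decay)
      where
      j = n ℕ.∸ start
      q = j / period
      n≡ : n ≡ j % period ℕ.+ q ℕ.* period ℕ.+ start
      n≡ = ≡.trans (≡.sym (ℕ.m∸n+n≡m (ℕ.≤-trans (ℕ.m≤n+m start _) Kp+s≤n)))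
                   (≡.cong (ℕ._+ start) (m≡m%n+[m/n]*n j period))
      K≤q : K ℕ.≤ q
      K≤q = ≡.subst (ℕ._≤ q) (m*n/n≡m K period)
        (/-monoˡ-≤ period (ℕ.m+n≤o⇒m≤o∸n (K ℕ.* period) Kp+s≤n))

  half : ∀ {x} → 0# < x → ∃[ h ] (0# < h × h + h ≈ x)
  half {x} 0<x with positive-inverse (+-nonNeg-pos 0≤1 0<1)
  ... | y , 0<y , 2y≈1 = y * x , *-pos 0<y 0<x ,
    trans (solve 2 (λ y x → y :* x :+ y :* x := (con (+ 1) :+ con (+ 1)) :* (y :* x)) refl y x)
          (x*inverse-cancel x 2y≈1)

  -- Two error terms are allowed because a truncated series brings two: the error of the partial sum
  -- and the remainder. If `x` were positive, each could be made smaller than half of it.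
  ≤-vanishing : ∀ {x e f} → Vanishes e → Vanishes f → (∀ k → x ≤ ∣ e k ∣ + ∣ f k ∣) → x ≤ 0#
  ≤-vanishing {x} {e} {f} e→0 f→0 x≤ with x ≤? 0#
  ... | yes x≤0 = x≤0
  ... | no  x≰0 = below-half (half (≰⇒> x≰0))
    where
    below-half : ∃[ h ] (0# < h × h + h ≈ x) → x ≤ 0#
    below-half (h , 0<h , h+h≈x) = contradiction
        (≤-trans (x≤ k) (+-monoʳ-≤ (∣ e k ∣) (<⇒≤ f<h)))
        (<⇒≱ (<-respʳ-≈ h+h≈x (+-monoˡ-< h e<h)))
      where
      N  = proj₁ (e→0 h 0<h)
      N′ = proj₁ (f→0 h 0<h)
      k  = N ℕ.⊔ N′
      e<h = proj₂ (e→0 h 0<h) k (ℕ.m≤m⊔n N N′)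
      f<h = proj₂ (f→0 h 0<h) k (ℕ.m≤n⊔m N N′)
  vanishing-difference : ∀ {x y e f} → Vanishes e → Vanishes f → (∀ k → x - y ≈ e k + f k) → x ≈ y
  vanishing-difference {x} {y} {e} {f} e→0 f→0 x-y≈ = trans
    (solve 2 (λ x y → x := (x :- y) :+ y) refl x y)
    (trans (+-congʳ (∣x∣≤0⇒x≈0 (≤-vanishing e→0 f→0 (λ k →
      ≤-trans (≤-reflexive (∣∣-cong (x-y≈ k))) (∣x+y∣≤ (e k) (f k)))))) (+-identityˡ y))

  -- Series whose weights contract periodically.

  productFrom : (ℕ → Carrier) → ℕ → ℕ → Carrier
  productFrom a s zero    = 1#
  productFrom a s (suc p) = a s * productFrom a (suc s) p

  Periodic : ℕ → ℕ → (ℕ → Carrier) → Set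
  Periodic s p b = ∀ j → b (j ℕ.+ s ℕ.+ p) ≈ b (j ℕ.+ s)

  -- The factors along a lasso: arbitrary on the stem, with product less than 1 over one turn of the
  -- cycle. Factors may be 0, so that absorbing marked nodes fit in.
  record Contracting (a : ℕ → Carrier) : Set where
    field
      start period : ℕ
      0<period     : 0 ℕ.< period
      periodic     : Periodic start period a
      0≤a          : ∀ k → 0# ≤ a k
      contracts    : productFrom a start period < 1#

  productFrom-nonNeg : ∀ {a} → (∀ k → 0# ≤ a k) → ∀ s p → 0# ≤ productFrom a s p
  productFrom-nonNeg 0≤a s zero    = 0≤1
  productFrom-nonNeg 0≤a s (suc p) = *-nonNeg (0≤a s) (productFrom-nonNeg 0≤a (suc s) p)

  -- The affine map of slope `r` that sends `s` to `t` has the fixed point `s + (t - s) / (1 - r)`,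
  -- and it scales distances from this point by `r`.
  fixed-error : ∀ t s {r κ} → (1# - r) * κ ≈ 1# →
                t - (s + κ * (t - s)) ≈ r * (s - (s + κ * (t - s)))
  fixed-error t s {r} {κ} inv = begin-equality
    t - (s + κ * (t - s))
      ≈⟨ solve 4 (λ t s κ r → t :- (s :+ κ :* (t :- s)) :=
           ((t :- s) :- (con (+ 1) :- r) :* (κ :* (t :- s))) :+ r :* (s :- (s :+ κ :* (t :- s)))) refl t s κ r ⟩
    ((t - s) - (1# - r) * (κ * (t - s))) + r * (s - (s + κ * (t - s)))
      ≈⟨ +-congʳ (+-congˡ (-‿cong (x*inverse-cancel (t - s) inv))) ⟩
    ((t - s) - (t - s)) + r * (s - (s + κ * (t - s)))
      ≈⟨ +-congʳ (-‿inverseʳ (t - s)) ⟩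
    0# + r * (s - (s + κ * (t - s)))
      ≈⟨ +-identityˡ _ ⟩
    r * (s - (s + κ * (t - s))) ∎
    where open ≤-Reasoning

  -- The weights `P` enter only through their recurrence, so the module serves both `prefixWeight`
  -- of a walk and `orbitWeight` of a policy.
  module ContractingSeries {a : ℕ → Carrier} (C : Contracting a)
    {P : ℕ → Carrier} (P-suc : ∀ k → P (suc k) ≈ P k * a k) where
    open Contracting C

    ρ : Carrier
    ρ = productFrom a start period

    P-productFrom : ∀ s p → P (s ℕ.+ p) ≈ P s * productFrom a s p
    P-productFrom s zero    = trans (reflexive (≡.cong P (ℕ.+-identityʳ s))) (sym (*-identityʳ _))
    P-productFrom s (suc p) = trans (reflexive (≡.cong P (ℕ.+-suc s p)))
      (trans (P-productFrom (suc s) p) (trans (*-congʳ (P-suc s)) (*-assoc _ _ _)))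

    P-recurrence : ∀ j → P (j ℕ.+ start ℕ.+ period) ≈ ρ * P (j ℕ.+ start)
    P-recurrence zero    = trans (P-productFrom start period) (*-comm _ _)
    P-recurrence (suc j) = trans (P-suc _) (trans (*-cong (P-recurrence j) (periodic j))
      (trans (*-assoc _ _ _) (*-congˡ (sym (P-suc _)))))

    weighted-geometric : ∀ {x} → Periodic start period x → Geometric (λ k → P k * x k)
    weighted-geometric {x} x-periodic = record
      { ratio      = ρ
      ; start      = start
      ; period     = period
      ; 0<period   = 0<period
      ; 0≤ratio    = productFrom-nonNeg 0≤a start period
      ; ratio<1    = contracts
      ; recurrence = λ j → trans (*-cong (P-recurrence j) (x-periodic j)) (*-assoc _ _ _)
      }

    module _ {b S : ℕ → Carrier} (b-periodic : Periodic start period b)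
             (S-suc : ∀ k → S (suc k) ≈ S k + P k * b k) where

      private
        Δ 1-ρ⁻¹ : Carrier
        Δ = S (start ℕ.+ period) - S start
        1-ρ⁻¹ = proj₁ (positive-inverse (x<y⇒0<y-x contracts))

      -- One period adds Δ, the next one ρ Δ, and so on.
      limit : Carrier
      limit = S start + 1-ρ⁻¹ * Δ

      -- The choice of `limit` matters only for `j = 0`. Afterwards the term added one period later
      -- is `ρ` times the term added now, which preserves the relation.
      error-recurrence : ∀ j → S (j ℕ.+ start ℕ.+ period) - limit ≈ ρ * (S (j ℕ.+ start) - limit)
      error-recurrence zero = fixed-error (S (start ℕ.+ period)) (S start) (proj₂ (proj₂ (positive-inverse (x<y⇒0<y-x contracts))))
      error-recurrence (suc j) = begin-equality
        S (suc k′) - limit                  ≈⟨ +-congʳ (S-suc k′) ⟩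
        (S k′ + P k′ * b k′) - limit        ≈⟨ +-congʳ (+-congˡ (*-cong (P-recurrence j) (b-periodic j))) ⟩
        (S k′ + (ρ * P k) * b k) - limit    ≈⟨ solve 5 (λ S′ ρ P b l → (S′ :+ (ρ :* P) :* b) :- l :=
                                                 (S′ :- l) :+ ρ :* (P :* b)) refl (S k′) ρ (P k) (b k) limit ⟩
        (S k′ - limit) + ρ * (P k * b k)    ≈⟨ +-congʳ (error-recurrence j) ⟩
        ρ * (S k - limit) + ρ * (P k * b k) ≈⟨ solve 4 (λ ρ S l x → ρ :* (S :- l) :+ ρ :* x := ρ :* ((S :+ x) :- l))
                                                 refl ρ (S k) limit (P k * b k) ⟩
        ρ * ((S k + P k * b k) - limit)     ≈⟨ *-congˡ (+-congʳ (S-suc k)) ⟨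
        ρ * (S (suc k) - limit)             ∎
        where
        open ≤-Reasoning
        k = j ℕ.+ start ; k′ = k ℕ.+ period

      error-geometric : Geometric (λ k → S k - limit)
      error-geometric = record
        { ratio      = ρ
        ; start      = start
        ; period     = period
        ; 0<period   = 0<period
        ; 0≤ratio    = productFrom-nonNeg 0≤a start period
        ; ratio<1    = contracts
        ; recurrence = error-recurrence
        }

-- The first repetition in a sequence with finitely many values.

module _ {n : ℕ} (x : ℕ → Fin n) where

  Distinct : ℕ → Set
  Distinct m = ∀ i j → i ℕ.< m → j ℕ.< m → x i ≡ x j → i ≡ j

  -- Stem length and period of a lasso. Distinctness of the first `s + p` terms is the clause
  -- required by `IsMonocycle`.
  FirstRepeat : Set
  FirstRepeat = ∃[ s ] ∃[ p ] (0 ℕ.< p × Distinct (s ℕ.+ p) × x (s ℕ.+ p) ≡ x s)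

  distinct-or-repeat : ∀ m → Distinct m ⊎ FirstRepeat
  distinct-or-repeat zero = inj₁ (λ _ _ ())
  distinct-or-repeat (suc m) with distinct-or-repeat m
  ... | inj₂ repeat   = inj₂ repeat
  ... | inj₁ distinct with ℕ.anyUpTo? (λ i → x i Fin.≟ x m) m
  ...   | yes (s , s<m , xs≡xm) = inj₂ (s , m ℕ.∸ s , ℕ.m<n⇒0<n∸m s<m ,
            ≡.subst (λ k → Distinct k × x k ≡ x s) (≡.sym (ℕ.m+[n∸m]≡n (ℕ.<⇒≤ s<m))) (distinct , ≡.sym xs≡xm))
  ...   | no  fresh = inj₁ (λ i j i<1+m j<1+m → distinct′ i j (ℕ.m<1+n⇒m<n∨m≡n i<1+m) (ℕ.m<1+n⇒m<n∨m≡n j<1+m))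
    where
    distinct′ : ∀ i j → i ℕ.< m ⊎ i ≡ m → j ℕ.< m ⊎ j ≡ m → x i ≡ x j → i ≡ j
    distinct′ i j (inj₁ i<m)    (inj₁ j<m)    xi≡xj = distinct i j i<m j<m xi≡xj
    distinct′ i j (inj₁ i<m)    (inj₂ ≡.refl) xi≡xj = contradiction (i , i<m , xi≡xj) fresh
    distinct′ i j (inj₂ ≡.refl) (inj₁ j<m)    xi≡xj = contradiction (j , j<m , ≡.sym xi≡xj) fresh
    distinct′ i j (inj₂ ≡.refl) (inj₂ ≡.refl) xi≡xj = ≡.refl

  firstRepeat : FirstRepeat
  firstRepeat with distinct-or-repeat (suc n)
  ... | inj₂ repeat   = repeat
  ... | inj₁ distinct with Fin.pigeonhole (ℕ.n<1+n n) (λ i → x (toℕ i))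
  ...   | i , j , i<j , xi≡xj = contradiction (distinct (toℕ i) (toℕ j) (Fin.toℕ<n i) (Fin.toℕ<n j) xi≡xj) (ℕ.<⇒≢ i<j)

-- Eventually periodic orbits.

module Orbits {X : Set} (F : X → X) where

  orbit : X → ℕ → X
  orbit u zero    = u
  orbit u (suc k) = F (orbit u k)

  orbit-suc : ∀ u k → orbit (F u) k ≡ orbit u (suc k)
  orbit-suc u zero    = ≡.refl
  orbit-suc u (suc k) = ≡.cong F (orbit-suc u k)

  orbit-+ : ∀ u j k → orbit u (j ℕ.+ k) ≡ orbit (orbit u k) j
  orbit-+ u zero    k = ≡.refl
  orbit-+ u (suc j) k = ≡.cong F (orbit-+ u j k)

  orbit-periodic : ∀ {u s p} → orbit u (s ℕ.+ p) ≡ orbit u s → ∀ j → orbit u (j ℕ.+ s ℕ.+ p) ≡ orbit u (j ℕ.+ s)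
  orbit-periodic eq zero    = eq
  orbit-periodic eq (suc j) = ≡.cong F (orbit-periodic eq j)

  orbit-multiple : ∀ {u s p} → orbit u (s ℕ.+ p) ≡ orbit u s → ∀ k → orbit u (k ℕ.* p ℕ.+ s) ≡ orbit u s
  orbit-multiple eq zero = ≡.refl
  orbit-multiple {u} {s} {p} eq (suc k) = begin
    orbit u (p ℕ.+ k ℕ.* p ℕ.+ s)       ≡⟨ ≡.cong (orbit u) (ℕ.+-assoc p (k ℕ.* p) s) ⟩
    orbit u (p ℕ.+ (k ℕ.* p ℕ.+ s))     ≡⟨ orbit-+ u p _ ⟩
    orbit (orbit u (k ℕ.* p ℕ.+ s)) p   ≡⟨ ≡.cong (λ w → orbit w p) (orbit-multiple eq k) ⟩
    orbit (orbit u s) p                 ≡⟨ orbit-+ u p s ⟨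
    orbit u (p ℕ.+ s)                   ≡⟨ ≡.cong (orbit u) (ℕ.+-comm p s) ⟩
    orbit u (s ℕ.+ p)                   ≡⟨ eq ⟩
    orbit u s                           ∎
    where open ≡.≡-Reasoning

  -- Going round the cycle `k` more times takes at least `k` steps, since `p` is positive. By then
  -- the orbit is stuck at `w`, yet it is back at `orbit u s`.
  repeat-after-fixed : ∀ {u s p k w} → 0 ℕ.< p → orbit u (s ℕ.+ p) ≡ orbit u s →
                       orbit u k ≡ w → (∀ j → orbit w j ≡ w) → orbit u s ≡ w
  repeat-after-fixed {u} {s} {p} {k} {w} 0<p eq reach fixed = begin
    orbit u s                      ≡⟨ orbit-multiple eq k ⟨
    orbit u (k ℕ.* p ℕ.+ s)        ≡⟨ ≡.cong (orbit u) (ℕ.m∸n+n≡m k≤kp+s) ⟨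
    orbit u (j ℕ.+ k)              ≡⟨ orbit-+ u j k ⟩
    orbit (orbit u k) j            ≡⟨ ≡.cong (λ w → orbit w j) reach ⟩
    orbit w j                      ≡⟨ fixed j ⟩
    w                              ∎
    where
    open ≡.≡-Reasoning
    j = k ℕ.* p ℕ.+ s ℕ.∸ k
    k≤kp+s : k ℕ.≤ k ℕ.* p ℕ.+ s
    k≤kp+s = ℕ.≤-trans (ℕ.m≤m*n k p ⦃ ℕ.>-nonZero 0<p ⦄) (ℕ.m≤m+n _ s)

-- Sums along walks.

module Walks {ℝ : RealNumbers} (Γ : MarkedNetwork ℝ) where
  open OrderedField ℝ
  open Sequences ℝ
  open MarkedNetwork Γ

  record InfiniteWalk (vs : ℕ → Fin #V) (es : ℕ → Edge Γ) : Set where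
    field
      sources : ∀ k → source (es k) ≡ inj₁ (vs k)
      targets : ∀ k → target (es k) ≡ inj₁ (vs (suc k))

    -- The end node is a variable tied by an equation, because one turn of a cycle needs the type
    -- `FiniteWalk Γ u u` although its two ends agree only propositionally.
    segment : ∀ n k {w} → inj₁ (vs (n ℕ.+ k)) ≡ w → FiniteWalk Γ (inj₁ (vs k)) w
    segment zero    k ≡.refl = ε
    segment (suc n) k end =
      step (es k) (sources k) (targets k) ◅ segment n (suc k) (≡.trans (≡.cong (λ i → inj₁ (vs i)) (ℕ.+-suc n k)) end)

    segment-weight : ∀ n k {w} (end : inj₁ (vs (n ℕ.+ k)) ≡ w) →
                     weight Γ (segment n k end) ≡ productFrom (λ i → α (es i)) k n
    segment-weight zero    k ≡.refl = ≡.refl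
    segment-weight (suc n) k end    = ≡.cong (α (es k) *_) (segment-weight n (suc k) _)

    segment-departures : ∀ n k {w} (end : inj₁ (vs (n ℕ.+ k)) ≡ w) →
      All (λ u → ∃[ i ] (k ℕ.≤ i × i ℕ.< n ℕ.+ k × u ≡ inj₁ (vs i))) (departures Γ (segment n k end))
    segment-departures zero    k ≡.refl = []
    segment-departures (suc n) k end    =
      (k , ℕ.≤-refl , s≤s (ℕ.m≤n+m k n) , ≡.refl) ∷
      All.map (λ (i , k<i , i<n+1+k , u≡) → i , ℕ.<⇒≤ k<i , ≡.subst (i ℕ.<_) (ℕ.+-suc n k) i<n+1+k , u≡)
              (segment-departures n (suc k) _)

    segment-unique : ∀ n k {w} (end : inj₁ (vs (n ℕ.+ k)) ≡ w) → Distinct vs (n ℕ.+ k) →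
                     Unique (departures Γ (segment n k end))
    segment-unique zero    k ≡.refl _ = []
    segment-unique (suc n) k end distinct =
      All.map (λ { (i , k<i , i<n+1+k , ≡.refl) vsk≡vsi → ℕ.<⇒≢ k<i
                   (distinct k i (s≤s (ℕ.m≤n+m k n)) (≡.subst (i ℕ.<_) (ℕ.+-suc n k) i<n+1+k)
                             (inj₁-injective vsk≡vsi)) })
              (segment-departures n (suc k) _)
      ∷ segment-unique n (suc k) _ (≡.subst (Distinct vs) (≡.sym (ℕ.+-suc n k)) distinct)

    segment-nonempty : ∀ n k {w} (end : inj₁ (vs (n ℕ.+ k)) ≡ w) → 0 ℕ.< n →
                       departures Γ (segment n k end) ≢ []
    segment-nonempty (suc n) k end _ ()

  module _ {vs : ℕ → Fin #V} {es : ℕ → Edge Γ} (walk : InfiniteWalk vs es) where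
    open InfiniteWalk walk

    monocycle-periodic : (mono : IsMonocycle Γ vs es) → let (s , p , _) = mono in
                         ∀ j → vs (j ℕ.+ s ℕ.+ p) ≡ vs (j ℕ.+ s)
    monocycle-periodic (s , p , _ , _ , es-periodic) j = inj₁-injective
      (≡.trans (≡.sym (sources (j ℕ.+ s ℕ.+ p)))
        (≡.trans (≡.cong source (es-periodic (j ℕ.+ s) (ℕ.m≤n+m s j))) (sources (j ℕ.+ s))))

    -- The point where `Gainy` is applied: the segment over one period is a cycle, as the monocycle
    -- repeats no node before closing up.
    monocycle-contracting : Gainy Γ → IsMonocycle Γ vs es → Contracting (λ k → α (es k))
    monocycle-contracting gainy mono@(s , p , 0<p , distinct , es-periodic) = record
      { start     = s
      ; period    = p
      ; 0<period  = 0<p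
      ; periodic  = λ j → reflexive (≡.cong α (es-periodic (j ℕ.+ s) (ℕ.m≤n+m s j)))
      ; 0≤a       = λ k → <⇒≤ (α-positive (es k))
      ; contracts = ≡.subst (_< 1#) (segment-weight p s closes)
          (gainy (segment p s closes)
            (segment-nonempty p s closes 0<p ,
             segment-unique p s closes (≡.subst (Distinct vs) (ℕ.+-comm s p) distinct)))
      }
      where
      closes : inj₁ (vs (p ℕ.+ s)) ≡ inj₁ (vs s)
      closes = ≡.cong inj₁ (≡.trans (≡.cong vs (ℕ.+-comm p s)) (monocycle-periodic mono 0))

  -- A supersolution of the Bellman equation, stated edge by edge so that it can be followed along
  -- any walk.
  IsUpperSolution : Point ℝ #V → Point ℝ #V → Set
  IsUpperSolution x y = ∀ e {v} → source e ≡ inj₁ v → y v + (α e * extend Γ x (target e) + c e) ≤ x v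

  module _ {x y : Point ℝ #V} (upper : IsUpperSolution x y) where

    -- Telescoping the inequalities of the edges. The factor `q` is the weight already accumulated
    -- and has to be general for the induction.
    finiteSum-≤ : ∀ {u a} (W : FiniteWalk Γ u (inj₂ a)) → All (IsUnmarked Γ) (departures Γ W) →
                  ∀ {q} → 0# ≤ q → finiteSumFrom Γ q W y ≤ q * extend Γ x u
    finiteSum-≤ ε [] 0≤q = ≤-refl
    finiteSum-≤ (step e src ≡.refl ◅ W) ((v , ≡.refl) ∷ unmarked) {q} 0≤q = begin
      q * (y v + c e) + finiteSumFrom Γ (q * α e) W y
        ≤⟨ +-monoʳ-≤ _ (finiteSum-≤ W unmarked (*-nonNeg 0≤q (<⇒≤ (α-positive e)))) ⟩
      q * (y v + c e) + (q * α e) * extend Γ x (target e)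
        ≈⟨ solve 5 (λ q y c a x → q :* (y :+ c) :+ (q :* a) :* x := q :* (y :+ (a :* x :+ c)))
             refl q (y v) (c e) (α e) (extend Γ x (target e)) ⟩
      q * (y v + (α e * extend Γ x (target e) + c e))
        ≤⟨ *-monoˡ-≤ 0≤q (upper e src) ⟩
      q * x v ∎
      where open ≤-Reasoning

  module _ {vs : ℕ → Fin #V} {es : ℕ → Edge Γ} where

    prefixWeight-nonNeg : ∀ k → 0# ≤ prefixWeight Γ es k
    prefixWeight-nonNeg zero    = 0≤1
    prefixWeight-nonNeg (suc k) = *-nonNeg (prefixWeight-nonNeg k) (<⇒≤ (α-positive (es k)))

    module _ (walk : InfiniteWalk vs es) (gainy : Gainy Γ) (mono : IsMonocycle Γ vs es) where
      open InfiniteWalk walk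
      private
        module Series = ContractingSeries (monocycle-contracting walk gainy mono) {prefixWeight Γ es} (λ _ → refl)

      remainder-vanishes : ∀ (x : Point ℝ #V) → Vanishes (λ k → prefixWeight Γ es k * x (vs k))
      remainder-vanishes x = geometric⇒vanishes
        (Series.weighted-geometric (λ j → reflexive (≡.cong x (monocycle-periodic walk mono j))))

      partialSum-converges : ∀ y → ∃[ s ] Vanishes (λ k → partialSum Γ vs es y k - s)
      partialSum-converges y = _ , geometric⇒vanishes
        (Series.error-geometric {S = partialSum Γ vs es y}
          (λ j → +-cong (reflexive (≡.cong y (monocycle-periodic walk mono j)))
                        (reflexive (≡.cong c (proj₂ (proj₂ (proj₂ (proj₂ mono))) _ (ℕ.m≤n+m _ j)))))
          (λ _ → refl))

      -- Keeping the remainder `prefixWeight Γ es k * x (vs k)` makes this an invariant of the walk;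
      -- the remainder vanishes only in the limit.
      partialSum-≤ : ∀ {x y} → IsUpperSolution x y → ∀ k →
                     partialSum Γ vs es y k + prefixWeight Γ es k * x (vs k) ≤ x (vs 0)
      partialSum-≤ {x} {y} upper zero = ≤-reflexive
        (solve 1 (λ x → con (+ 0) :+ con (+ 1) :* x := x) refl (x (vs 0)))
      partialSum-≤ {x} {y} upper (suc k) = begin
        (S + P * (y (vs k) + c e)) + (P * α e) * x (vs (suc k))
          ≈⟨ solve 6 (λ S P y c a x → (S :+ P :* (y :+ c)) :+ (P :* a) :* x := S :+ P :* (y :+ (a :* x :+ c)))
               refl S P (y (vs k)) (c e) (α e) (x (vs (suc k))) ⟩
        S + P * (y (vs k) + (α e * x (vs (suc k)) + c e))
          ≡⟨ ≡.cong (λ w → S + P * (y (vs k) + (α e * extend Γ x w + c e))) (targets k) ⟨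
        S + P * (y (vs k) + (α e * extend Γ x (target e) + c e))
          ≤⟨ +-monoʳ-≤ S (*-monoˡ-≤ (prefixWeight-nonNeg k) (upper e (sources k))) ⟩
        S + P * x (vs k)
          ≤⟨ partialSum-≤ upper k ⟩
        x (vs 0) ∎
        where
        open ≤-Reasoning
        S = partialSum Γ vs es y k ; P = prefixWeight Γ es k ; e = es k

      infiniteSum-≤ : ∀ {x y s} → IsUpperSolution x y → Vanishes (λ k → partialSum Γ vs es y k - s) → s ≤ x (vs 0)
      infiniteSum-≤ {x} {y} {s} upper S→s = ≤-from-difference
        (x≤y⇒0≤y-x (≤-vanishing S→s (remainder-vanishes x) bound))
        (solve 2 (λ x s → x := s :+ (con (+ 0) :- (s :- x))) refl (x (vs 0)) s)
        where
        open ≤-Reasoning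
        bound : ∀ k → s - x (vs 0) ≤ ∣ partialSum Γ vs es y k - s ∣ + ∣ prefixWeight Γ es k * x (vs k) ∣
        bound k = begin
          s - x₀              ≤⟨ ≤-from-difference (x≤y⇒0≤y-x (partialSum-≤ upper k))
                                  (solve 4 (λ s x S r → (:- (S :- s)) :+ (:- r) := (s :- x) :+ (x :- (S :+ r)))
                                    refl s x₀ S r) ⟩
          - (S - s) + - r     ≤⟨ +-mono-≤ (-x≤∣x∣ _) (-x≤∣x∣ _) ⟩
          ∣ S - s ∣ + ∣ r ∣   ∎
          where x₀ = x (vs 0) ; S = partialSum Γ vs es y k ; r = prefixWeight Γ es k * x (vs k)

      tightSum-≈ : ∀ {x y s} → (∀ k → x (vs k) ≈ y (vs k) + (α (es k) * x (vs (suc k)) + c (es k))) →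
                   Vanishes (λ k → partialSum Γ vs es y k - s) → s ≈ x (vs 0)
      tightSum-≈ {x} {y} {s} tight S→s = sym (vanishing-difference S→s (remainder-vanishes x) (λ k → trans
          (+-congʳ (telescope k))
          (solve 3 (λ S r s → (S :+ r) :- s := (S :- s) :+ r) refl
            (partialSum Γ vs es y k) (prefixWeight Γ es k * x (vs k)) s)))
        where
        telescope : ∀ k → x (vs 0) ≈ partialSum Γ vs es y k + prefixWeight Γ es k * x (vs k)
        telescope zero    = solve 1 (λ x → x := con (+ 0) :+ con (+ 1) :* x) refl (x (vs 0))
        telescope (suc k) = trans (telescope k) (trans (+-congˡ (*-congˡ (tight k)))
          (solve 6 (λ S P y c a x → S :+ P :* (y :+ (a :* x :+ c)) := (S :+ P :* (y :+ c)) :+ (P :* a) :* x)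
            refl (partialSum Γ vs es y k) (prefixWeight Γ es k) (y (vs k)) (c (es k)) (α (es k)) (x (vs (suc k)))))

-- Policies and their values.

module Policies {ℝ : RealNumbers} (Γ : MarkedNetwork ℝ) (gainy : Gainy Γ) where
  open OrderedField ℝ
  open PiecewiseLinear ℝ
  open Sequences ℝ
  open MarkedNetwork Γ
  open Walks Γ

  IsPolicy : (Fin #V → Edge Γ) → Set
  IsPolicy π = ∀ v → source (π v) ≡ inj₁ v

  module Policy (π : Fin #V → Edge Γ) (π-policy : IsPolicy π) where

    next : Node Γ → Node Γ
    next (inj₁ v) = target (π v)
    next (inj₂ a) = inj₂ a

    open Orbits next

    -- Giving marked nodes a loop of weight 0 makes every orbit an infinite walk
    -- that ends up in a contracting cycle.
    gain : Node Γ → Carrier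
    gain (inj₁ v) = α (π v)
    gain (inj₂ a) = 0#

    gain-nonNeg : ∀ u → 0# ≤ gain u
    gain-nonNeg (inj₁ v) = <⇒≤ (α-positive (π v))
    gain-nonNeg (inj₂ a) = ≤-refl

    orbit-marked : ∀ a k → orbit (inj₂ a) k ≡ inj₂ a
    orbit-marked a zero    = ≡.refl
    orbit-marked a (suc k) = ≡.cong next (orbit-marked a k)

    ReachesMarked : Node Γ → Set
    ReachesMarked u = ∃[ k ] ∃[ a ] (orbit u k ≡ inj₂ a)

    RunsIntoCycle : Node Γ → Set
    RunsIntoCycle u = Σ[ vs ∈ (ℕ → Fin #V) ]
      ((∀ k → orbit u k ≡ inj₁ (vs k)) × IsMonocycle Γ vs (λ k → π (vs k)))

    encode : Node Γ → Fin (#V ℕ.+ #A)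
    encode = Fin.join #V #A

    encode-injective : ∀ {u w} → encode u ≡ encode w → u ≡ w
    encode-injective {u} {w} eq = ≡.trans (≡.sym (Fin.splitAt-join #V #A u))
      (≡.trans (≡.cong (Fin.splitAt #V) eq) (Fin.splitAt-join #V #A w))

    -- Inspecting the recurring node `orbit u s` suffices. Marked nodes are fixed by `next`, so an
    -- orbit that ever met one would have a marked recurring node.
    orbit-dichotomy : ∀ u → ReachesMarked u ⊎ RunsIntoCycle u
    orbit-dichotomy u with firstRepeat (λ k → encode (orbit u k))
    ... | s , p , 0<p , distinct , repeat = classify (orbit u s) ≡.refl
      where
      repeats : orbit u (s ℕ.+ p) ≡ orbit u s
      repeats = encode-injective repeat

      classify : ∀ w → orbit u s ≡ w → ReachesMarked u ⊎ RunsIntoCycle u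
      classify (inj₂ a) us≡a = inj₁ (s , a , us≡a)
      classify (inj₁ v) us≡v = inj₂ (vs , us≡vs , s , p , 0<p , vs-distinct , es-periodic)
        where
        unmarked : ∀ k w → orbit u k ≡ w → ∃[ v ] (orbit u k ≡ inj₁ v)
        unmarked k (inj₁ v) uk≡v = v , uk≡v
        unmarked k (inj₂ a) uk≡a
          with ≡.trans (≡.sym us≡v) (repeat-after-fixed {s = s} {k = k} 0<p repeats uk≡a (orbit-marked a))
        ... | ()

        vs : ℕ → Fin #V
        vs k = proj₁ (unmarked k (orbit u k) ≡.refl)

        us≡vs : ∀ k → orbit u k ≡ inj₁ (vs k)
        us≡vs k = proj₂ (unmarked k (orbit u k) ≡.refl)

        vs-distinct : Distinct vs (s ℕ.+ p)
        vs-distinct i j i< j< vsi≡vsj = distinct i j i< j< (≡.cong encode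
          (≡.trans (us≡vs i) (≡.trans (≡.cong inj₁ vsi≡vsj) (≡.sym (us≡vs j)))))

        es-periodic : ∀ k → s ℕ.≤ k → π (vs (k ℕ.+ p)) ≡ π (vs k)
        es-periodic k s≤k = ≡.cong π (inj₁-injective (≡.trans (≡.sym (us≡vs (k ℕ.+ p)))
          (≡.trans (≡.subst (λ k → orbit u (k ℕ.+ p) ≡ orbit u k) (ℕ.m∸n+n≡m s≤k)
                            (orbit-periodic repeats (k ℕ.∸ s)))
                   (us≡vs k))))

    cycle-walk : ∀ {u} ((vs , us≡vs , _) : RunsIntoCycle u) → InfiniteWalk vs (λ k → π (vs k))
    cycle-walk (vs , us≡vs , _) = record
      { sources = λ k → π-policy (vs k)
      ; targets = λ k → ≡.trans (≡.cong next (≡.sym (us≡vs k))) (us≡vs (suc k))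
      }

    productFrom-cong : ∀ {a b : ℕ → Carrier} → (∀ k → a k ≡ b k) → ∀ s p → productFrom a s p ≡ productFrom b s p
    productFrom-cong a≡b s zero    = ≡.refl
    productFrom-cong a≡b s (suc p) = ≡.cong₂ _*_ (a≡b s) (productFrom-cong a≡b (suc s) p)

    orbit-contracting : ∀ u → Σ[ C ∈ Contracting (λ k → gain (orbit u k)) ] let open Contracting C in
                        ∀ j → orbit u (j ℕ.+ start ℕ.+ period) ≡ orbit u (j ℕ.+ start)
    orbit-contracting u with orbit-dichotomy u
    ... | inj₁ (k , a , uk≡a) = record
          { start     = k
          ; period    = 1
          ; 0<period  = s≤s z≤n
          ; periodic  = λ j → reflexive (≡.cong gain (fixed j))
          ; 0≤a       = λ k → gain-nonNeg (orbit u k)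
          ; contracts = ≡.subst (λ w → gain w * 1# < 1#) (≡.sym uk≡a)
                          (≤-<-trans (≤-reflexive (zeroˡ 1#)) 0<1)
          } , fixed
      where
      fixed : ∀ j → orbit u (j ℕ.+ k ℕ.+ 1) ≡ orbit u (j ℕ.+ k)
      fixed = orbit-periodic (≡.trans (≡.cong (orbit u) (ℕ.+-comm k 1)) (≡.trans (≡.cong next uk≡a) (≡.sym uk≡a)))
    ... | inj₂ cycle@(vs , us≡vs , mono) = record
          { Contracting C
              hiding (periodic; 0≤a; contracts)
          ; periodic  = λ j → reflexive (≡.cong gain (recurs j))
          ; 0≤a       = λ k → gain-nonNeg (orbit u k)
          ; contracts = ≡.subst (_< 1#)
              (productFrom-cong (λ k → ≡.sym (≡.cong gain (us≡vs k))) (Contracting.start C) (Contracting.period C))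
              (Contracting.contracts C)
          } , recurs
      where
      C : Contracting (λ k → α (π (vs k)))
      C = monocycle-contracting (cycle-walk cycle) gainy mono
      open Contracting C using (start; period)
      recurs : ∀ j → orbit u (j ℕ.+ start ℕ.+ period) ≡ orbit u (j ℕ.+ start)
      recurs j = ≡.trans (us≡vs _) (≡.trans (≡.cong inj₁ (monocycle-periodic (cycle-walk cycle) mono j)) (≡.sym (us≡vs _)))

    orbitWeight : Node Γ → ℕ → Carrier
    orbitWeight u zero    = 1#
    orbitWeight u (suc k) = orbitWeight u k * gain (orbit u k)

    orbitWeight-nonNeg : ∀ u k → 0# ≤ orbitWeight u k
    orbitWeight-nonNeg u zero    = 0≤1
    orbitWeight-nonNeg u (suc k) = *-nonNeg (orbitWeight-nonNeg u k) (gain-nonNeg (orbit u k))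

    -- Weights are extended at the far end of the orbit, whereas the linear system relates `u` to
    -- `next u`; hence the first factor is peeled off here.
    orbitWeight-next : ∀ u k → orbitWeight u (suc k) ≈ gain u * orbitWeight (next u) k
    orbitWeight-next u zero    = *-comm _ _
    orbitWeight-next u (suc k) = trans
      (*-cong (orbitWeight-next u k) (reflexive (≡.cong gain (≡.sym (orbit-suc u k)))))
      (*-assoc _ _ _)

    -- A maximum principle for the homogeneous system: iterating the hypothesis bounds `D u` by a
    -- weight times a later value of `D`. These values recur periodically while the weights decay.
    subsolution-≤0 : ∀ (D : Node Γ → Carrier) → (∀ u → D u ≤ gain u * D (next u)) → ∀ u → D u ≤ 0#
    subsolution-≤0 D D≤ u = ≤-vanishing tail→0 tail→0 (λ k → begin
        D u                                    ≤⟨ iterate k ⟩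
        tail k                                 ≤⟨ x≤∣x∣ _ ⟩
        ∣ tail k ∣                             ≤⟨ ≤-from-difference (∣x∣-nonNeg (tail k)) refl ⟩
        ∣ tail k ∣ + ∣ tail k ∣                ∎)
      where
      open ≤-Reasoning
      C = orbit-contracting u
      tail : ℕ → Carrier
      tail k = orbitWeight u k * D (orbit u k)
      tail→0 : Vanishes tail
      tail→0 = geometric⇒vanishes (ContractingSeries.weighted-geometric (proj₁ C) {orbitWeight u} (λ _ → refl)
                 (λ j → reflexive (≡.cong D (proj₂ C j))))
      iterate : ∀ k → D u ≤ tail k
      iterate zero    = ≤-reflexive (sym (*-identityˡ _))
      iterate (suc k) = begin
        D u                                                        ≤⟨ iterate k ⟩
        orbitWeight u k * D (orbit u k)                            ≤⟨ *-monoˡ-≤ (orbitWeight-nonNeg u k) (D≤ (orbit u k)) ⟩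
        orbitWeight u k * (gain (orbit u k) * D (orbit u (suc k))) ≈⟨ *-assoc _ _ _ ⟨
        orbitWeight u (suc k) * D (orbit u (suc k))                ∎

    module _ (b : Node Γ → Carrier) where

      orbitSum : Node Γ → ℕ → Carrier
      orbitSum u zero    = 0#
      orbitSum u (suc k) = orbitSum u k + orbitWeight u k * b (orbit u k)

      orbitSum-next : ∀ u k → orbitSum u (suc k) ≈ b u + gain u * orbitSum (next u) k
      orbitSum-next u zero = solve 2 (λ b g → con (+ 0) :+ con (+ 1) :* b := b :+ g :* con (+ 0)) refl (b u) (gain u)
      orbitSum-next u (suc k) = trans
        (+-cong (orbitSum-next u k)
                (*-cong (orbitWeight-next u k) (reflexive (≡.cong b (≡.sym (orbit-suc u k))))))
        (solve 5 (λ b g S P b′ → (b :+ g :* S) :+ (g :* P) :* b′ := b :+ g :* (S :+ P :* b′)) refl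
          (b u) (gain u) (orbitSum (next u) k) (orbitWeight (next u) k) (b (orbit (next u) k)))

      -- Unfolding the limits is prohibitively slow.
      abstract
        orbitSum-converges : ∀ u → ∃[ l ] Geometric (λ k → orbitSum u k - l)
        orbitSum-converges u = _ , ContractingSeries.error-geometric
          (proj₁ (orbit-contracting u)) {orbitWeight u} (λ _ → refl)
          (λ j → reflexive (≡.cong b (proj₂ (orbit-contracting u) j))) (λ _ → refl)

      solution : Node Γ → Carrier
      solution u = proj₁ (orbitSum-converges u)

      -- Both sides are limits of the one sequence `orbitSum u (suc k)`, read once as a shifted
      -- series at `u` and once as a series at `next u`.
      solution-solves : ∀ u → solution u ≈ b u + gain u * solution (next u)
      solution-solves u = sym (vanishing-difference
        (geometric⇒vanishes (geometric-shift (proj₂ (orbitSum-converges u))))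
        (geometric⇒vanishes (geometric-* (- gain u) (proj₂ (orbitSum-converges (next u)))))
        (λ k → trans
          (solve 5 (λ z b g z′ S → (b :+ g :* z′) :- z := ((b :+ g :* S) :- z) :+ (:- g) :* (S :- z′)) refl
            (solution u) (b u) (gain u) (solution (next u)) (orbitSum (next u) k))
          (+-congʳ (+-congʳ (sym (orbitSum-next u k))))))

    -- The value of π is affine in y, with these coefficients: the linear system
    -- for its values is solved for every unit vector and for the constant part.
    unitPart : Fin #V → Node Γ → Carrier
    unitPart i (inj₁ v) = indicator v i
    unitPart i (inj₂ a) = 0#

    constantPart : Node Γ → Carrier
    constantPart (inj₁ v) = c (π v)
    constantPart (inj₂ a) = marking a

    valueForm : Node Γ → AffineForm ℝ #V
    valueForm u = record
      { coefficient = λ i → solution (unitPart i) u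
      ; constant    = solution constantPart u
      }

    value : Point ℝ #V → Point ℝ #V
    value y v = AffineForm.eval (valueForm (inj₁ v)) y

    valueForm-solves : ∀ y u → AffineForm.eval (valueForm u) y ≈
      (sum (λ i → unitPart i u * y i) + constantPart u) + gain u * AffineForm.eval (valueForm (next u)) y
    valueForm-solves y u = begin-equality
      sum (λ i → G u i * y i) + H u
        ≈⟨ +-cong (sum-cong-≋ {#V} (λ i → trans (*-congʳ (solution-solves (unitPart i) u))
              (solve 4 (λ b g z y → (b :+ g :* z) :* y := b :* y :+ g :* (z :* y)) refl
                (unitPart i u) (gain u) (G (next u) i) (y i))))
             (solution-solves constantPart u) ⟩
      sum (λ i → unitPart i u * y i + gain u * (G (next u) i * y i)) + (constantPart u + gain u * H (next u))
        ≈⟨ +-congʳ (trans (∑-distrib-+ (λ i → unitPart i u * y i) (λ i → gain u * (G (next u) i * y i)))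
                          (+-congˡ (sym (*-distribˡ-sum (gain u) (λ i → G (next u) i * y i))))) ⟩
      (B + gain u * S) + (constantPart u + gain u * H (next u))
        ≈⟨ solve 5 (λ B g S h H → (B :+ g :* S) :+ (h :+ g :* H) := (B :+ h) :+ g :* (S :+ H)) refl
             B (gain u) S (constantPart u) (H (next u)) ⟩
      (B + constantPart u) + gain u * (S + H (next u)) ∎
      where
      open ≤-Reasoning
      G : Node Γ → Fin #V → Carrier
      G u i = solution (unitPart i) u
      H = solution constantPart
      B = sum (λ i → unitPart i u * y i)
      S = sum (λ i → G (next u) i * y i)

    valueForm-extend : ∀ y u → AffineForm.eval (valueForm u) y ≈ extend Γ (value y) u
    valueForm-extend y (inj₁ v) = refl
    valueForm-extend y (inj₂ a) = trans (valueForm-solves y (inj₂ a)) (trans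
      (+-cong (+-congʳ (trans (sum-cong-≋ {#V} (λ i → zeroˡ (y i))) (sum-replicate-zero #V))) (zeroˡ _))
      (solve 1 (λ m → (con (+ 0) :+ m) :+ con (+ 0) := m) refl (marking a)))

    IsTight : Point ℝ #V → Point ℝ #V → Set
    IsTight x y = ∀ v → x v ≈ y v + (α (π v) * extend Γ x (target (π v)) + c (π v))

    value-tight : ∀ y → IsTight (value y) y
    value-tight y v = trans (valueForm-solves y (inj₁ v)) (trans
      (+-cong (+-congʳ (sum-indicator v y)) (*-congˡ (valueForm-extend y (target (π v)))))
      (solve 4 (λ y c a x → (y :+ c) :+ a :* x := y :+ (a :* x :+ c)) refl
        (y v) (c (π v)) (α (π v)) (extend Γ (value y) (target (π v)))))

    -- In the difference of a subsolution and a supersolution `y` and `c` cancel, and at marked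
    -- nodes it is 0; what remains is the homogeneous inequality. Uniqueness uses it with `x` tight,
    -- policy improvement with `x′` tight.
    comparison : ∀ {x x′ y : Point ℝ #V} →
      (∀ v → x v ≤ y v + (α (π v) * extend Γ x (target (π v)) + c (π v))) →
      (∀ v → y v + (α (π v) * extend Γ x′ (target (π v)) + c (π v)) ≤ x′ v) →
      ∀ u → extend Γ x u ≤ extend Γ x′ u
    comparison {x} {x′} {y} lower upper u = ≤-from-difference (x≤y⇒0≤y-x (subsolution-≤0 D D≤ u))
      (solve 2 (λ x x′ → x′ := x :+ (con (+ 0) :- (x :- x′))) refl (extend Γ x u) (extend Γ x′ u))
      where
      D : Node Γ → Carrier
      D u = extend Γ x u - extend Γ x′ u
      D≤ : ∀ u → D u ≤ gain u * D (next u)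
      D≤ (inj₁ v) = ≤-from-difference (+-nonNeg (x≤y⇒0≤y-x (lower v)) (x≤y⇒0≤y-x (upper v)))
        (solve 7 (λ x x′ y a c t t′ → a :* (t :- t′) :=
            (x :- x′) :+ (((y :+ (a :* t :+ c)) :- x) :+ (x′ :- (y :+ (a :* t′ :+ c))))) refl
          (x v) (x′ v) (y v) (α (π v)) (c (π v)) (extend Γ x (target (π v))) (extend Γ x′ (target (π v))))
      D≤ (inj₂ a) = ≤-reflexive (solve 1 (λ m → m :- m := con (+ 0) :* (m :- m)) refl (marking a))

    -- The field `onOrbit` strengthens the induction: it is what shows that a node put in front does
    -- not reappear later.
    record PathFollowing (u : Node Γ) : Set where
      field
        {end}    : Fin #A
        path     : FiniteWalk Γ u (inj₂ end)
        unmarked : All (IsUnmarked Γ) (departures Γ path)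
        isPath   : IsPath Γ path
        onOrbit  : All (λ w → ∃[ k ] (w ≡ orbit u k)) (nodes Γ path)
        tightSum : ∀ {x y} → IsTight x y → ∀ q → finiteSumFrom Γ q path y ≈ q * extend Γ x u

    -- The number `k` is only a bound for the recursion: the path stops at the first marked node,
    -- where the orbit then stays.
    followPath : ∀ k u {a} → orbit u k ≡ inj₂ a → PathFollowing u
    followPath k (inj₂ a) _ = record
      { path     = ε
      ; unmarked = []
      ; isPath   = [] ∷ []
      ; onOrbit  = (0 , ≡.refl) ∷ []
      ; tightSum = λ _ _ → refl
      }
    followPath (suc k) (inj₁ v) {a} reach = record
      { path     = step (π v) (π-policy v) ≡.refl ◅ path
      ; unmarked = (v , ≡.refl) ∷ unmarked
      ; isPath   = All.map fresh onOrbit ∷ isPath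
      ; onOrbit  = (0 , ≡.refl) ∷ All.map (λ (j , w≡) → suc j , ≡.trans w≡ (orbit-suc (inj₁ v) j)) onOrbit
      ; tightSum = λ {x} {y} tight q → trans (+-congˡ (tightSum tight (q * α (π v))))
          (trans (solve 5 (λ q y c a x → q :* (y :+ c) :+ (q :* a) :* x := q :* (y :+ (a :* x :+ c))) refl
                   q (y v) (c (π v)) (α (π v)) (extend Γ x (target (π v))))
                 (*-congˡ (sym (tight v))))
      }
      where
      open PathFollowing (followPath k (target (π v)) (≡.trans (orbit-suc (inj₁ v) k) reach))

      -- If `inj₁ v` came back, its orbit would be periodic from the start and so could not be
      -- absorbed by a marked node.
      fresh : ∀ {w} → ∃[ j ] (w ≡ orbit (target (π v)) j) → inj₁ v ≢ w
      fresh (j , w≡) v≡w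
        with repeat-after-fixed {inj₁ v} {s = 0} {p = suc j} {k = suc k} (s≤s z≤n)
               (≡.sym (≡.trans v≡w (≡.trans w≡ (orbit-suc (inj₁ v) j)))) reach (orbit-marked a)
      ... | ()

    -- The sum is identified rather than constructed, since membership in `𝒞` supplies some `s`
    -- together with `HasSum`.
    tight-walk : ∀ {x y} → IsTight x y → ∀ {u} →
                 Σ[ W ∈ 𝒲 Γ u ] (In𝒲̂ Γ W × (∀ s → HasSum Γ W y s → s ≈ extend Γ x u))
    tight-walk {x} {y} tight {u} with orbit-dichotomy u
    ... | inj₁ (k , a , reach) = finite path unmarked , isPath ,
          λ s sum≈s → trans (sym sum≈s) (trans (tightSum tight 1#) (*-identityˡ _))
      where open PathFollowing (followPath k u reach)
    ... | inj₂ cycle@(vs , us≡vs , mono) =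
          infinite vs (λ k → π (vs k)) (us≡vs 0) sources targets , mono ,
          λ s S→s → trans
            (tightSum-≈ (cycle-walk cycle) gainy mono {x = x}
              (λ k → trans (tight (vs k)) (+-congˡ (+-congʳ (*-congˡ (reflexive (≡.cong (extend Γ x) (targets k)))))))
              S→s)
            (reflexive (≡.cong (extend Γ x) (≡.sym (us≡vs 0))))
      where open InfiniteWalk (cycle-walk cycle)

-- Maxima over finite sets and monotonicity of sums.

module Maxima (ℝ : RealNumbers) where
  open OrderedField ℝ
  private module E = Extrema totalOrder

  module _ {B : Set} (f : B → Carrier) where

    maximumOf-upper : ∀ bs (nonempty : bs ≢ []) {b} → b ∈ bs → f b ≤ maximumOf ℝ f (toNonEmpty bs nonempty)
    maximumOf-upper []       nonempty _            = contradiction ≡.refl nonempty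
    maximumOf-upper (b ∷ bs) nonempty (here ≡.refl) = E.⊥≤max (f b) (map f bs)
    maximumOf-upper (b ∷ bs) nonempty (there b′∈)   = All.lookup (E.xs≤max (f b) (map f bs)) (∈-map⁺ f b′∈)

    maximumOf-attained : ∀ bs (nonempty : bs ≢ []) → ∃[ b ] (b ∈ bs × maximumOf ℝ f (toNonEmpty bs nonempty) ≡ f b)
    maximumOf-attained []       nonempty = contradiction ≡.refl nonempty
    maximumOf-attained (b ∷ bs) nonempty with E.argmax-sel (λ r → r) (f b) (map f bs)
    ... | inj₁ max≡fb = b , here ≡.refl , max≡fb
    ... | inj₂ max∈   = let (b′ , b′∈ , max≡) = ∈-map⁻ f max∈ in b′ , there b′∈ , max≡

  finite-argmax : ∀ {N} (f : Fin N → Carrier) → Fin N → ∃[ i ] (∀ j → f j ≤ f i)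
  finite-argmax {suc zero}    f _ = zero , λ { zero → ≤-refl }
  finite-argmax {suc (suc N)} f _ with finite-argmax (λ j → f (suc j)) zero
  ... | i , f≤fi with total (f zero) (f (suc i))
  ...   | inj₁ f0≤fi = suc i , λ { zero → f0≤fi ; (suc j) → f≤fi j }
  ...   | inj₂ fi≤f0 = zero  , λ { zero → ≤-refl ; (suc j) → ≤-trans (f≤fi j) fi≤f0 }

  sum-mono-≤ : ∀ {n} {x x′ : Point ℝ n} → (∀ i → x i ≤ x′ i) → sum x ≤ sum x′
  sum-mono-≤ {zero}  x≤x′ = ≤-refl
  sum-mono-≤ {suc n} x≤x′ = +-mono-≤ (x≤x′ zero) (sum-mono-≤ (λ i → x≤x′ (suc i)))

  sum-mono-< : ∀ {n} {x x′ : Point ℝ n} → (∀ i → x i ≤ x′ i) → ∀ j → x j < x′ j → sum x < sum x′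
  sum-mono-< {suc n} {x} {x′} x≤x′ zero x<x′ =
    <-≤-trans (+-monoˡ-< _ x<x′) (+-monoʳ-≤ (x′ zero) (sum-mono-≤ (λ i → x≤x′ (suc i))))
  sum-mono-< {suc n} {x} {x′} x≤x′ (suc j) x<x′ =
    ≤-<-trans (+-monoˡ-≤ _ (x≤x′ zero))
      (<-≤-trans (≤-<-trans (≤-reflexive (+-comm _ _)) (+-monoˡ-< (x′ zero) (sum-mono-< (λ i → x≤x′ (suc i)) j x<x′)))
                 (≤-reflexive (+-comm _ _)))

-- The Bellman equation and the transfer map.

module Transfer {ℝ : RealNumbers} (Γ : MarkedNetwork ℝ) (gainy : Gainy Γ) (sinksMarked : AllSinksMarked Γ) where
  open OrderedField ℝ
  open PiecewiseLinear ℝ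
  open Maxima ℝ
  open MarkedNetwork Γ
  open Walks Γ
  open Policies Γ gainy

  edgeValue : Point ℝ #V → Edge Γ → Carrier
  edgeValue x e = α e * extend Γ x (target e) + c e

  best : Point ℝ #V → Fin #V → Carrier
  best x v = maximumOf ℝ (edgeValue x) (toNonEmpty (outgoing Γ v) (outgoing≢[] Γ sinksMarked v))

  startsAt? : ∀ v e → Dec (source e ≡ inj₁ v)
  startsAt? v e = _≟ᴺ_ Γ (source e) (inj₁ v)

  best-upper : ∀ x {v e} → source e ≡ inj₁ v → edgeValue x e ≤ best x v
  best-upper x {v} {e} src = maximumOf-upper (edgeValue x) (outgoing Γ v) _
    (∈-filter⁺ (startsAt? v) (∈-allFin e) src)

  best-attained : ∀ x v → ∃[ e ] (source e ≡ inj₁ v × best x v ≡ edgeValue x e)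
  best-attained x v =
    let (e , e∈ , best≡) = maximumOf-attained (edgeValue x) (outgoing Γ v) (outgoing≢[] Γ sinksMarked v)
    in e , proj₂ (∈-filter⁻ (startsAt? v) {xs = allFin #E} e∈) , best≡

  greedy : Point ℝ #V → Fin #V → Edge Γ
  greedy x v = proj₁ (best-attained x v)

  greedy-isPolicy : ∀ x → IsPolicy (greedy x)
  greedy-isPolicy x v = proj₁ (proj₂ (best-attained x v))

  IsSolution : Point ℝ #V → Point ℝ #V → Set
  IsSolution x y = ∀ v → x v ≈ y v + best x v

  solution⇒upper : ∀ {x y} → IsSolution x y → IsUpperSolution x y
  solution⇒upper {x} {y} solves e {v} src =
    ≤-trans (+-monoʳ-≤ (y v) (best-upper x src)) (≤-reflexive (sym (solves v)))

  -- The policy is greedy for the function to be bounded: `x` is then tight along it, and `x′`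
  -- satisfies the inequality of every edge anyway.
  solution-≤ : ∀ {x x′ y} → IsSolution x y → IsSolution x′ y → ∀ v → x v ≤ x′ v
  solution-≤ {x} {x′} {y} solves solves′ v = Policy.comparison (greedy x) (greedy-isPolicy x)
    (λ w → ≤-reflexive (trans (solves w) (+-congˡ (reflexive (proj₂ (proj₂ (best-attained x w)))))))
    (λ w → solution⇒upper solves′ (greedy x w) (greedy-isPolicy x w))
    (inj₁ v)

  solution-unique : ∀ {x x′ y} → IsSolution x y → IsSolution x′ y → ∀ v → x v ≈ x′ v
  solution-unique solves solves′ v = antisym (solution-≤ solves solves′ v) (solution-≤ solves′ solves v)

  #policies : ℕ
  #policies = #E ℕ.^ #V

  -- Policies are coded by all functions from nodes to edges; a value that is not
  -- an edge starting at the node in question is replaced by some edge that is.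
  correct : ∀ v (e : Edge Γ) → Dec (source e ≡ inj₁ v) → Edge Γ
  correct v e (yes _) = e
  correct v e (no  _) = greedy (λ _ → 0#) v

  policy : Fin #policies → Fin #V → Edge Γ
  policy i v = correct v (finToFun i v) (startsAt? v (finToFun i v))

  policy-isPolicy : ∀ i → IsPolicy (policy i)
  policy-isPolicy i v with startsAt? v (finToFun {#E} {#V} i v)
  ... | yes src = src
  ... | no  _   = greedy-isPolicy (λ _ → 0#) v

  policy-funToFin : ∀ {π} → IsPolicy π → ∀ v → policy (funToFin π) v ≡ π v
  policy-funToFin {π} isPolicy v rewrite Fin.finToFun-funToFin π v with startsAt? v (π v)
  ... | yes _    = ≡.refl
  ... | no  ¬src = contradiction (isPolicy v) ¬src

  valueOf : Fin #policies → Point ℝ #V → Point ℝ #V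
  valueOf i = Policy.value (policy i) (policy-isPolicy i)

  valueOf-tight : ∀ i y v → valueOf i y v ≈ y v + edgeValue (valueOf i y) (policy i v)
  valueOf-tight i = Policy.value-tight (policy i) (policy-isPolicy i)

  -- Tightness gives one inequality, as the edge of the policy competes in the maximum; the
  -- supersolution property at a maximising edge gives the other.
  upper⇒solution : ∀ i {y} → IsUpperSolution (valueOf i y) y → IsSolution (valueOf i y) y
  upper⇒solution i {y} upper v = antisym
    (≤-trans (≤-reflexive (valueOf-tight i y v)) (+-monoʳ-≤ (y v) (best-upper _ (policy-isPolicy i v))))
    (≤-trans (≤-reflexive (+-congˡ (reflexive best≡))) (upper e src))
    where
    attained = best-attained (valueOf i y) v
    e     = proj₁ attained
    src   = proj₁ (proj₂ attained)
    best≡ = proj₂ (proj₂ attained)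

  optimum : ∀ y → ∃[ i ] (∀ j → sum (valueOf j y) ≤ sum (valueOf i y))
  -- The greedy policy at the zero point merely shows that there is a policy to search among.
  optimum y = finite-argmax (λ i → sum (valueOf i y)) (funToFin (greedy (λ _ → 0#)))

  -- The policy found by the search may jump with `y`, but by `solution-unique` every policy whose
  -- value solves the Bellman equation yields the same point.
  ψ : Point ℝ #V → Point ℝ #V
  ψ y = valueOf (proj₁ (optimum y)) y

  -- Policy improvement: switching the optimal policy to an edge violating the
  -- inequality would increase the sum of its values.
  ψ-upper : ∀ y → IsUpperSolution (ψ y) y
  ψ-upper y e {v} src with (y v + edgeValue (ψ y) e) ≤? ψ y v
  ... | yes ≤x = ≤x
  ... | no  ≰x = contradiction (proj₂ (optimum y) i′) (<⇒≱ (sum-mono-< (λ w → x≤x′ (inj₁ w)) v x<x′))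
    where
    i = proj₁ (optimum y)
    x = ψ y

    switch : ∀ w → Dec (w ≡ v) → Edge Γ
    switch w (yes _) = e
    switch w (no  _) = policy i w

    π′ : Fin #V → Edge Γ
    π′ w = switch w (w Fin.≟ v)

    π′-isPolicy : IsPolicy π′
    π′-isPolicy w with w Fin.≟ v
    ... | yes ≡.refl = src
    ... | no  _      = policy-isPolicy i w

    i′ = funToFin π′
    x′ = valueOf i′ y

    policy-i′-v : policy i′ v ≡ e
    policy-i′-v = ≡.trans (policy-funToFin π′-isPolicy v) switch-v
      where
      switch-v : π′ v ≡ e
      switch-v with v Fin.≟ v
      ... | yes _   = ≡.refl
      ... | no  v≢v = contradiction ≡.refl v≢v

    -- The old value is a subsolution for the switched policy: by the violated inequality at `v`,
    -- and by tightness at all other nodes.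
    lower : ∀ w → x w ≤ y w + edgeValue x (policy i′ w)
    lower w rewrite policy-funToFin π′-isPolicy w with w Fin.≟ v
    ... | yes ≡.refl = <⇒≤ (≰⇒> ≰x)
    ... | no  _      = ≤-reflexive (valueOf-tight i y w)

    x≤x′ : ∀ u → extend Γ x u ≤ extend Γ x′ u
    x≤x′ = Policy.comparison (policy i′) (policy-isPolicy i′) lower
             (λ w → ≤-reflexive (sym (valueOf-tight i′ y w)))

    -- Strictness comes from the violation at `v`; that the target of `e` has not lost value carries
    -- it over to `x′`.
    x<x′ : x v < x′ v
    x<x′ = <-≤-trans (≰⇒> ≰x) (begin
      y v + edgeValue x e                ≤⟨ +-monoʳ-≤ (y v) (+-monoˡ-≤ (c e)
                                              (*-monoˡ-≤ (<⇒≤ (α-positive e)) (x≤x′ (target e)))) ⟩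
      y v + edgeValue x′ e               ≡⟨ ≡.cong (λ e → y v + edgeValue x′ e) policy-i′-v ⟨
      y v + edgeValue x′ (policy i′ v)   ≈⟨ valueOf-tight i′ y v ⟨
      x′ v                               ∎)
      where open ≤-Reasoning

  ψ-solution : ∀ y → IsSolution (ψ y) y
  ψ-solution y = upper⇒solution (proj₁ (optimum y)) (ψ-upper y)

  φ-solution : ∀ x → IsSolution x (φ Γ sinksMarked x)
  φ-solution x v = solve 2 (λ x m → x := (x :- m) :+ m) refl (x v) (best x v)

  φ-mapsTo : MapsTo ℝ (𝒪 Γ) (𝒞 Γ) (φ Γ sinksMarked)
  φ-mapsTo x x∈𝒪 = nonNeg , walks
    where
    open ≤-Reasoning
    y = φ Γ sinksMarked x
    upper : IsUpperSolution x y
    upper = solution⇒upper (φ-solution x)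

    nonNeg : ∀ v → 0# ≤ y v
    nonNeg v = let (e , src , best≡) = best-attained x v in
      x≤y⇒0≤y-x (≤-trans (≤-reflexive (reflexive best≡)) (≡.subst (λ u → edgeValue x e ≤ extend Γ x u) src (x∈𝒪 e)))

    bound : ∀ {a e s} → source e ≡ inj₂ a → s ≤ extend Γ x (target e) → α e * s + c e ≤ marking a
    bound {a} {e} src s≤ = ≤-trans (+-monoˡ-≤ (c e) (*-monoˡ-≤ (<⇒≤ (α-positive e)) s≤))
      (≡.subst (λ u → edgeValue x e ≤ extend Γ x u) src (x∈𝒪 e))

    walks : ∀ a e → source e ≡ inj₂ a → (W : 𝒲 Γ (target e)) → In𝒲̂ Γ W →
            ∃[ s ] (HasSum Γ W y s × α e * s + c e ≤ marking a)
    walks a e src (finite W unmarked) _ = finiteSumFrom Γ 1# W y , refl ,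
      bound src (≤-trans (finiteSum-≤ upper W unmarked 0≤1) (≤-reflexive (*-identityˡ _)))
    walks a e src (infinite vs es start sources targets) mono =
      let walk = record { sources = sources ; targets = targets }
          (s , S→s) = partialSum-converges walk gainy mono y
      in s , S→s , bound src (≤-trans (infiniteSum-≤ walk gainy mono upper S→s)
                                (≤-reflexive (reflexive (≡.cong (extend Γ x) (≡.sym start)))))

  ψ-mapsTo : MapsTo ℝ (𝒞 Γ) (𝒪 Γ) ψ
  ψ-mapsTo y (0≤y , walks) e = at (source e) ≡.refl
    where
    i = proj₁ (optimum y)
    at : ∀ u → source e ≡ u → edgeValue (ψ y) e ≤ extend Γ (ψ y) u
    at (inj₁ v) src = ≤-trans (≤-from-difference (0≤y v) (+-comm (y v) _)) (ψ-upper y e src)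
    at (inj₂ a) src =
      let (W , W∈𝒲̂ , sum≈) = Policy.tight-walk (policy i) (policy-isPolicy i) (valueOf-tight i y) {target e}
          (s , hasSum , s≤) = walks a e src W W∈𝒲̂
      in ≤-trans (≤-reflexive (+-congʳ (*-congˡ (sym (sum≈ s hasSum))))) s≤

  -- The inequalities of a piece: one for each edge starting in an unmarked node.
  atUnmarked : (Fin #V → Carrier) → Node Γ → Carrier
  atUnmarked f (inj₁ v) = f v
  atUnmarked f (inj₂ a) = 0#

  atUnmarked-nonNeg : ∀ {f} u → (∀ v → u ≡ inj₁ v → 0# ≤ f v) → 0# ≤ atUnmarked f u
  atUnmarked-nonNeg (inj₁ v) 0≤f = 0≤f v ≡.refl
  atUnmarked-nonNeg (inj₂ a) 0≤f = ≤-refl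

  atUnmarked-affine : ∀ {f : Point ℝ #V → Fin #V → Carrier} u → (∀ v → IsAffine (λ x → f x v)) →
                      IsAffine (λ x → atUnmarked (f x) u)
  atUnmarked-affine (inj₁ v) f-affine = f-affine v
  atUnmarked-affine (inj₂ a) f-affine = affine-constant 0#

  edgeValue-affine : ∀ {x : Point ℝ #V → Point ℝ #V} → (∀ v → IsAffine (λ y → x y v)) →
                     ∀ e → IsAffine (λ y → edgeValue (x y) e)
  edgeValue-affine {x} x-affine e = affine-+ (affine-* (α e) (extend-affine (target e))) (affine-constant (c e))
    where
    extend-affine : ∀ u → IsAffine (λ y → extend Γ (x y) u)
    extend-affine (inj₁ v) = x-affine v
    extend-affine (inj₂ a) = affine-constant (marking a)

  -- Piece `i` is the set of points at which policy `i` selects a maximising edge at every node, so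
  -- that each maximum is the value of the selected edge.
  φ-piecewiseLinear : PiecewiseLinearOn ℝ (𝒪 Γ) (φ Γ sinksMarked)
  φ-piecewiseLinear = finite-piecewiseLinear {N = #policies}
    (λ i e x → atUnmarked (λ v → edgeValue x (policy i v) - edgeValue x e) (source e))
    (λ i x v → x v - edgeValue x (policy i v))
    (λ i e → atUnmarked-affine (source e) (λ v →
      affine-difference (edgeValue-affine affine-coordinate (policy i v)) (edgeValue-affine affine-coordinate e)))
    (λ i v → affine-difference (affine-coordinate v) (edgeValue-affine affine-coordinate (policy i v)))
    (λ x _ → funToFin (greedy x) , λ e → atUnmarked-nonNeg (source e) (λ v src → x≤y⇒0≤y-x
      (≤-trans (best-upper x src) (≤-reflexive (reflexive (≡.trans (proj₂ (proj₂ (best-attained x v)))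
        (≡.cong (edgeValue x) (≡.sym (policy-funToFin (greedy-isPolicy x) v)))))))))
    (λ x _ i 0≤slack v → +-congˡ (-‿cong (antisym
      (let (e , src , best≡) = best-attained x v in
       ≤-trans (≤-reflexive (reflexive best≡)) (0≤y-x⇒x≤y
         (≡.subst (λ u → 0# ≤ atUnmarked (λ v → edgeValue x (policy i v) - edgeValue x e) u) src (0≤slack e))))
      (best-upper x (policy-isPolicy i v)))))

  -- Piece `i` is the set of `y` for which the value of policy `i` is a supersolution; being tight
  -- it is then the solution, and uniqueness identifies it with `ψ y`.
  ψ-piecewiseLinear : PiecewiseLinearOn ℝ (𝒞 Γ) ψ
  ψ-piecewiseLinear = finite-piecewiseLinear {N = #policies}
    (λ i e y → atUnmarked (λ v → valueOf i y v - (y v + edgeValue (valueOf i y) e)) (source e))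
    valueOf
    (λ i e → atUnmarked-affine (source e) (λ v →
      affine-difference (valueOf-affine i v) (affine-+ (affine-coordinate v) (edgeValue-affine (valueOf-affine i) e))))
    valueOf-affine
    (λ y _ → proj₁ (optimum y) , λ e → atUnmarked-nonNeg (source e) (λ v src → x≤y⇒0≤y-x (ψ-upper y e src)))
    (λ y _ i 0≤slack → solution-unique (ψ-solution y) (upper⇒solution i (λ e src → 0≤y-x⇒x≤y
      (≡.subst (λ u → 0# ≤ atUnmarked (λ v → valueOf i y v - (y v + edgeValue (valueOf i y) e)) u) src (0≤slack e)))))
    where
    valueOf-affine : ∀ i v → IsAffine (λ y → valueOf i y v)
    valueOf-affine i v = Policy.valueForm (policy i) (policy-isPolicy i) (inj₁ v) , λ _ → refl

theorem4p2 : (ℝ : RealNumbers) (Γ : MarkedNetwork ℝ) →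
    Gainy Γ → (sinksMarked : AllSinksMarked Γ) →
    RestrictsToPLHomeomorphism ℝ (𝒪 Γ) (𝒞 Γ) (φ Γ sinksMarked)
theorem4p2 ℝ Γ gainy sinksMarked = record
  { inverseMap              = ψ
  ; mapsTo                  = φ-mapsTo
  ; inverse-mapsTo          = ψ-mapsTo
  ; inverseˡ                = λ x _ → solution-unique (ψ-solution (φ Γ sinksMarked x)) (φ-solution x)
  ; inverseʳ                = λ y _ v → trans (+-congʳ (ψ-solution y v))
      (solve 2 (λ y m → (y :+ m) :- m := y) refl (y v) (best (ψ y) v))
  ; continuous              = piecewiseLinear⇒continuous φ-piecewiseLinear
  ; inverse-continuous      = piecewiseLinear⇒continuous ψ-piecewiseLinear
  ; piecewiseLinear         = φ-piecewiseLinear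
  ; inverse-piecewiseLinear = ψ-piecewiseLinear
  }
  where
  open OrderedField ℝ
  open PiecewiseLinear ℝ
  open Transfer Γ gainy sinksMarked
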